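{- For all $n,k\ge 0$ there are explicit bijections between $\mathcal{M}_n^k(321)$ and $\mathcal{D}^2_{n,k}$, and between $\mathcal{M}_n^k(213)$ and $\mathcal{D}^2_{n,k}$.
   Context: A (not necessarily perfect) matching on $[m]$ is a set of disjoint pairs $(i,j)$, $i<j$, of elements of $[m]$; unmatched elements are fixed points. A perfect matching $M$ of $[2n]$ avoids $\tau\in S_3$ if there are no $i_1<\dots<i_6$ with all pairs $(i_a,i_{7-\tau(a)})$, $a=1,2,3$, in $M$. $\mathcal{M}_n^k(321)$ is the set of matchings on $[2n+k]$ with exactly $k$ fixed points such that (i) removing the fixed points and relabeling the remaining elements increasingly by $1,\dots,2n$ gives a $321$-avoiding perfect matching, and (ii) for any $x_1<x_2<x_3<x_4<x_5$ with $(x_1,x_4)$ and $(x_2,x_5)$ matched, $x_3$ is not a fixed point. $\mathcal{M}_n^k(213)$ is the set of matchings on $[2n+k]$ with exactly $k$ fixed points such that (i) removing the fixed points and relabeling gives a $213$-avoiding perfect matching, and (ii) for any $x_1<\dots<x_5$ with $(x_1,x_5)$ and $(x_3,x_4)$ matched, $x_2$ is not a fixed point. A Dyck path of semilength $m$ is a lattice path from $(0,m)$ to $(m,0)$ with unit east and south steps never going strictly below $y=m-x$. $\mathcal{D}^2_{m}$ is the set of pairs $(D_0,D_1)$ of such paths with $D_0$ never strictly above $D_1$, and $\mathcal{D}^2_{n,k}$ is the set of pairs $(D_0,D_1)\in\mathcal{D}^2_{n+k}$ such that both $D_0$ and $D_1$ end with $k$ south steps. -}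

module Defs where

open import Data.Nat as ℕ using (ℕ; zero; suc; _+_; _*_; _∸_; _<_)
open import Data.Integer as ℤ using (ℤ; +_; _-_) renaming (_≤_ to _≤ℤ_; _+_ to _+ℤ_)
open import Data.Fin as Fin using (Fin; toℕ)
open import Data.Vec using (Vec; lookup)
open import Data.List using (List; []; _∷_; _++_; filter; length; replicate)
open import Data.List.Relation.Unary.All using (All)
open import Data.List.Relation.Unary.Any using (Any)
open import Data.Fin.Base using (Fin)
open import Data.List using () renaming (map to mapL)
open import Data.Fin using () renaming (_<?_ to _<F?_; _≟_ to _≟F_)
open import Data.Product using (Σ; ∃; ∃-syntax; _×_; _,_)
open import Data.Refinement using (Refinement; Refinement-syntax)
open import Relation.Nullary using (¬_)
open import Relation.Nullary.Decidable using (_×-dec_; ¬?)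
open import Relation.Binary.PropositionalEquality using (_≡_; _≢_)

-- Matchings on [m] = Fin m, represented by their partner function:
-- v[i] = partner of i, and v[i] = i iff i is a fixed point.
-- A vector v is a matching iff it is an involution.

allFin : (m : ℕ) → List (Fin m)
allFin m = Data.List.tabulate (λ i → i)
  where import Data.List

IsMatching : {m : ℕ} → Vec (Fin m) m → Set
IsMatching {m} v = ∀ (i : Fin m) → lookup v (lookup v i) ≡ i

Fixed : {m : ℕ} → Vec (Fin m) m → Fin m → Set
Fixed v i = lookup v i ≡ i

InM : {m : ℕ} → Vec (Fin m) m → Fin m → Fin m → Set
InM v i j = (i Fin.< j) × (lookup v i ≡ j)

numFixed : {m : ℕ} → Vec (Fin m) m → ℕ
numFixed {m} v = length (filter (λ i → lookup v i ≟F i) (allFin m))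

-- Relabelling after removing fixed points: a non-fixed point p receives
-- the new label  rank v p = #{ non-fixed i : i < p }  (labels start at 0).
rank : {m : ℕ} → Vec (Fin m) m → Fin m → ℕ
rank {m} v p = length (filter (λ i → (i <F? p) ×-dec ¬? (lookup v i ≟F i)) (allFin m))

RedPair : {m : ℕ} → Vec (Fin m) m → ℕ → ℕ → Set
RedPair {m} v a b = ∃[ p ] ∃[ q ] (InM v p q × rank v p ≡ a × rank v q ≡ b)

-- Pattern avoidance for perfect matchings (given by their set of pairs R).
-- τ ∈ S₃ is given 0-based: τ : Fin 3 → Fin 3 with τ a = τ(a+1) - 1.
-- An occurrence is i₁<…<i₆ (here ι 0 < … < ι 5) with (i_a , i_{7-τ(a)}) ∈ M,
-- i.e. (ι a , ι (5 - τ a)) in 0-based form.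

Avoids : (Fin 3 → Fin 3) → (ℕ → ℕ → Set) → Set
Avoids τ R = ¬ (Σ (ℕ → ℕ) λ ι →
                  (∀ t → t < 5 → ι t < ι (suc t)) ×
                  (∀ (a : Fin 3) → R (ι (toℕ a)) (ι (5 ∸ toℕ (τ a)))))

τ321 : Fin 3 → Fin 3
τ321 Fin.zero = Fin.suc (Fin.suc Fin.zero)
τ321 (Fin.suc Fin.zero) = Fin.suc Fin.zero
τ321 (Fin.suc (Fin.suc Fin.zero)) = Fin.zero

τ213 : Fin 3 → Fin 3
τ213 Fin.zero = Fin.suc Fin.zero
τ213 (Fin.suc Fin.zero) = Fin.zero
τ213 (Fin.suc (Fin.suc Fin.zero)) = Fin.suc (Fin.suc Fin.zero)

Cond321 : {m : ℕ} → Vec (Fin m) m → Set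
Cond321 {m} v = ∀ (x₁ x₂ x₃ x₄ x₅ : Fin m) →
  x₁ Fin.< x₂ → x₂ Fin.< x₃ → x₃ Fin.< x₄ → x₄ Fin.< x₅ →
  InM v x₁ x₄ → InM v x₂ x₅ → ¬ Fixed v x₃

Cond213 : {m : ℕ} → Vec (Fin m) m → Set
Cond213 {m} v = ∀ (x₁ x₂ x₃ x₄ x₅ : Fin m) →
  x₁ Fin.< x₂ → x₂ Fin.< x₃ → x₃ Fin.< x₄ → x₄ Fin.< x₅ →
  InM v x₁ x₅ → InM v x₃ x₄ → ¬ Fixed v x₂

Mnk : (τ : Fin 3 → Fin 3) → (∀ {m} → Vec (Fin m) m → Set) → ℕ → ℕ → Set
Mnk τ cond n k =
  [ v ∈ Vec (Fin (2 * n + k)) (2 * n + k) ∣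
      IsMatching v × numFixed v ≡ k × Avoids τ (RedPair v) × cond v ]

M321 : ℕ → ℕ → Set
M321 = Mnk τ321 Cond321

M213 : ℕ → ℕ → Set
M213 = Mnk τ213 Cond213

data Step : Set where
  E S : Step

points : ℤ × ℤ → List Step → List (ℤ × ℤ)
points p [] = p ∷ []
points (x , y) (E ∷ s) = (x , y) ∷ points (x +ℤ + 1 , y) s
points (x , y) (S ∷ s) = (x , y) ∷ points (x , y - + 1) s

endpoint : ℤ × ℤ → List Step → ℤ × ℤ
endpoint p [] = p
endpoint (x , y) (E ∷ s) = endpoint (x +ℤ + 1 , y) s
endpoint (x , y) (S ∷ s) = endpoint (x , y - + 1) s

start : ℕ → ℤ × ℤ
start m = (+ 0 , + m)

IsDyck : ℕ → List Step → Set
IsDyck m D = endpoint (start m) D ≡ (+ m , + 0)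
           × All (λ { (x , y) → (+ m - x) ≤ℤ y }) (points (start m) D)

NotAbove : ℕ → List Step → List Step → Set
NotAbove m D₀ D₁ =
  All (λ { (x , y) → Any (λ { (x' , y') → x' ≡ x × y ≤ℤ y' }) (points (start m) D₁) })
      (points (start m) D₀)

EndsWithS : ℕ → List Step → Set
EndsWithS k D = ∃[ P ] D ≡ P ++ replicate k S

IsD2 : ℕ → List Step × List Step → Set
IsD2 m (D₀ , D₁) = IsDyck m D₀ × IsDyck m D₁ × NotAbove m D₀ D₁

D2nk : ℕ → ℕ → Set
D2nk n k = [ P ∈ List Step × List Step ∣
             IsD2 (n + k) P × EndsWithS k (Data.Product.proj₁ P) × EndsWithS k (Data.Product.proj₂ P) ]

{-# OPTIONS --safe #-}
module Submission where

open import Defs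
open import Data.Nat using (ℕ)
open import Data.Product using (_×_)
open import Function.Bundles using (_⤖_)

open import Data.Empty using (⊥; ⊥-elim; ⊥-elim-irr)
open import Data.Fin as Fin using (Fin; zero; suc; toℕ; fromℕ<; punchIn; punchOut; opposite)
open import Data.Integer as ℤ using (ℤ; +_; _-_) renaming (_+_ to _+ℤ_; _≤_ to _≤ℤ_)
open import Data.Irrelevant using ([_])
open import Data.List as List using (List; []; _∷_; _++_; filter; length; replicate; reverse; tails)
open import Data.List.Membership.Propositional using (_∈_)
open import Data.List.Membership.Propositional.Properties using (∈-tabulate⁺)
open import Data.List.Relation.Unary.All as All using (All; []; _∷_)
open import Data.List.Relation.Unary.Any as Any using (Any; here; there)
open import Data.Nat as ℕ using (zero; suc; _+_; _*_; _∸_; _≤_; _<_; z≤n; s≤s)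
open import Data.Nat.Tactic.RingSolver using (solve-∀)
open import Data.Product using (Σ; ∃; ∃-syntax; _,_; proj₁; proj₂)
open import Data.Refinement using (Refinement; _,_; value; value-injective)
open import Data.Sum as Sum using (_⊎_; inj₁; inj₂)
open import Data.Vec as Vec using (Vec; []; _∷_; lookup; tabulate)
open import Data.Vec.Functional using (removeAt)
open import Function using (_∘_; id)
open import Function.Bundles using (mk⤖)
open import Level using (0ℓ)
open import Relation.Binary.Definitions using (tri<; tri≈; tri>)
open import Relation.Binary.PropositionalEquality
open import Relation.Nullary using (¬_; Dec; yes; no; contradiction; Recomputable; recompute)
open import Relation.Nullary.Decidable using (_×-dec_; ¬?; map′)
open import Relation.Nullary.Recomputable using (_×-recompute_; ¬-recompute)
open import Relation.Unary using (Decidable; Pred)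
import Data.Fin.Permutation as Perm
import Data.Fin.Properties as Finₚ
import Data.Integer.Properties as ℤₚ
import Data.List.Properties as Listₚ
import Data.List.Relation.Unary.All.Properties as Allₚ
import Data.List.Relation.Unary.Any.Properties as Anyₚ
import Data.Nat.Properties as ℕₚ
import Data.Product.Properties as Productₚ
import Data.Vec.Properties as Vecₚ
open import Algebra.Properties.CommutativeMonoid.Sum ℕₚ.+-0-commutativeMonoid using (sum; sum-cong-≗; sum-permute; sum-remove)

-- Build a matching by adding points on the right; a point not yet matched is a fixed
-- point, and both avoidance conditions become restrictions on which fixed point may be
-- matched next.  In every case the upper path has an east step for a point that is fixed
-- when it arrives and a south step for a point that closes an arc.
--
-- 213: the fixed points to the left of some left end of an arc must be matched from right
-- to left.  If h points are fixed and a of them are so restricted, the next arc may bring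
-- a to any value from a ∸ 1 to h ∸ 1, which are the moves of a Dyck path below the
-- upper one.
--
-- 321: reading from the right, apply Schensted insertion to the left ends of arcs, starting
-- from a single row for the k fixed points.  Avoidance means that the tableaux have at most
-- two rows; the difference of the row lengths changes by one at each point, never exceeds
-- the number of entries, and traces the lower path.

-- After all 2n+k points both paths stand at height k, so the k final south steps of each are forced
-- padding; the work concerns pairs of words of length 2n+k that meet at height k. For 321, the left
-- ends of a forbidden triple are inserted from right to left. They form a decreasing sequence of
-- length three, which is what creates a third row. The k fixed points start as one increasing row,
-- because such a point can only be the first member of a triple. If the rows differ by d and the
-- second has length s, then h = d + 2s: staying above the diagonal is d ≥ 0 and not crossing is s ≥
-- 0. Each step is reversible, since the letter tells from which row reverse insertion starts.
-- Schensted's theorem on longest decreasing sequences is not invoked; a local invariant,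
-- `Compatible`, links the tableau with the arcs and is carried through insertion in both
-- directions. For 213 the lower path moves only at closures, so in between it lags behind; the
-- `free c` east steps that it still owes are added before the two paths are compared.

-- Matchings on m points with h fixed points, grown on the right end.  Points and
-- fixed points are numbered from right to left, so zero is the newest one, and
-- close c j matches a new point with the j-th fixed point of c.
data Code : ℕ → ℕ → Set where
  empty : Code 0 0
  fixed : ∀ {m h} → Code m h → Code (suc m) (suc h)
  close : ∀ {m h} → Code m (suc h) → Fin (suc h) → Code (suc m) h

fix : ∀ {m h} → Code m h → Fin h → Fin m
fix (fixed c) zero = zero
fix (fixed c) (suc i) = suc (fix c i)
fix (close c j) i = suc (fix c (punchIn j i))

partner : ∀ {m h} → Code m h → Fin m → Fin m
partner (fixed c) zero = zero
partner (fixed c) (suc x) = suc (partner c x)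
partner (close c j) zero = suc (fix c j)
partner (close c j) (suc x) with x Fin.≟ fix c j
... | yes _ = zero
... | no _ = suc (partner c x)

-- Order and partners in a code

<⇒≢ : ∀ {m} {x y : Fin m} → x Fin.< y → x ≢ y
<⇒≢ x<y refl = ℕₚ.<-irrefl refl x<y

punchIn-mono-< : ∀ {n} (j : Fin (suc n)) {i i' : Fin n} → i Fin.< i' → punchIn j i Fin.< punchIn j i'
punchIn-mono-< j {i} {i'} i<i' = ℕₚ.≰⇒> λ le → ℕₚ.<⇒≱ i<i' (Finₚ.punchIn-cancel-≤ j i' i le)

punchIn-< : ∀ {n} (j : Fin (suc n)) (i : Fin n) → toℕ i < toℕ j → toℕ (punchIn j i) ≡ toℕ i
punchIn-< (suc j) zero lt = refl
punchIn-< (suc j) (suc i) (s≤s lt) = cong suc (punchIn-< j i lt)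

punchIn-≥ : ∀ {n} (j : Fin (suc n)) (i : Fin n) → toℕ j ≤ toℕ i → toℕ (punchIn j i) ≡ suc (toℕ i)
punchIn-≥ zero i le = refl
punchIn-≥ (suc j) (suc i) (s≤s le) = cong suc (punchIn-≥ j i le)

fix-mono : ∀ {m h} (c : Code m h) {i i'} → i Fin.< i' → fix c i Fin.< fix c i'
fix-mono (fixed c) {zero} {suc i'} lt = s≤s z≤n
fix-mono (fixed c) {suc i} {suc i'} (s≤s lt) = s≤s (fix-mono c lt)
fix-mono (close c j) lt = s≤s (fix-mono c (punchIn-mono-< j lt))

fix-cancel-< : ∀ {m h} (c : Code m h) {i i'} → fix c i Fin.< fix c i' → i Fin.< i'
fix-cancel-< c {i} {i'} lt with Finₚ.<-cmp i i'
... | tri< p _ _ = p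
... | tri≈ _ refl _ = ⊥-elim (ℕₚ.<-irrefl refl lt)
... | tri> _ _ p = ⊥-elim (ℕₚ.<-asym lt (fix-mono c p))

fix-injective : ∀ {m h} (c : Code m h) {i i'} → fix c i ≡ fix c i' → i ≡ i'
fix-injective c {i} {i'} e with Finₚ.<-cmp i i'
... | tri< p _ _ = ⊥-elim (<⇒≢ (fix-mono c p) e)
... | tri≈ _ refl _ = refl
... | tri> _ _ p = ⊥-elim (<⇒≢ (fix-mono c p) (sym e))

partner-close-≢ : ∀ {m h} (c : Code m (suc h)) j {x} → x ≢ fix c j →
    partner (close c j) (suc x) ≡ suc (partner c x)
partner-close-≢ c j {x} ne with x Fin.≟ fix c j
... | yes e = contradiction e ne
... | no _ = refl

partner-close-fix : ∀ {m h} (c : Code m (suc h)) j → partner (close c j) (suc (fix c j)) ≡ zero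
partner-close-fix c j with fix c j Fin.≟ fix c j
... | yes e = refl
... | no ne = contradiction refl ne

partner-fix : ∀ {m h} (c : Code m h) i → partner c (fix c i) ≡ fix c i
partner-fix (fixed c) zero = refl
partner-fix (fixed c) (suc i) = cong suc (partner-fix c i)
partner-fix (close c j) i =
  trans (partner-close-≢ c j (Finₚ.punchInᵢ≢i j i ∘ fix-injective c)) (cong suc (partner-fix c (punchIn j i)))

fix-surjective : ∀ {m h} (c : Code m h) x → partner c x ≡ x → ∃[ i ] fix c i ≡ x
fix-surjective (fixed c) zero e = zero , refl
fix-surjective (fixed c) (suc x) e with fix-surjective c x (Finₚ.suc-injective e)
... | i , refl = suc i , refl
fix-surjective (close c j) (suc x) e with x Fin.≟ fix c j
... | no ne with fix-surjective c x (Finₚ.suc-injective e)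
...   | i , refl = Fin.punchOut j≢i , cong (suc ∘ fix c) (Finₚ.punchIn-punchOut j≢i)
  where
  j≢i : j ≢ i
  j≢i refl = ne refl

partner-involutive : ∀ {m h} (c : Code m h) x → partner c (partner c x) ≡ x
partner-involutive (fixed c) zero = refl
partner-involutive (fixed c) (suc x) = cong suc (partner-involutive c x)
partner-involutive (close c j) zero = partner-close-fix c j
partner-involutive (close c j) (suc x) with x Fin.≟ fix c j
... | yes e = cong suc (sym e)
... | no ne = trans (partner-close-≢ c j λ e → ne (trans (sym (partner-involutive c x))
    (trans (cong (partner c) e) (partner-fix c j))))
                    (cong suc (partner-involutive c x))

-- Every involution has exactly one code

truncate : ∀ {m} → (Fin (suc m) → Fin (suc m)) → Fin m → Fin m
truncate u x with u (suc x)
... | zero = x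
... | suc y = y

truncate-suc : ∀ {m} (u : Fin (suc m) → Fin (suc m)) {x y} → u (suc x) ≡ suc y → truncate u x ≡ y
truncate-suc u {x} e with u (suc x)
truncate-suc u refl | suc y = refl

truncate-zero : ∀ {m} (u : Fin (suc m) → Fin (suc m)) {x} → u (suc x) ≡ zero → truncate u x ≡ x
truncate-zero u {x} e with u (suc x)
... | zero = refl

-- Forgetting the newest point turns its partner into a fixed point and leaves an involution. By
-- induction this has a code, in which the freed partner is the fixed point to close.
encode : ∀ {m} (u : Fin m → Fin m) → (∀ x → u (u x) ≡ x) → ∃[ h ] Σ (Code m h) λ c → ∀ x → partner c x ≡ u x
encode {zero} u inv = 0 , empty , λ ()
encode {suc m} u inv with encode (truncate u) inv′
  where
  inv′ : ∀ x → truncate u (truncate u x) ≡ x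
  inv′ x with u (suc x) in e
  ... | zero = truncate-zero u e
  ... | suc y = truncate-suc u (trans (cong u (sym e)) (inv (suc x)))
... | h , c , pc = cases h c pc (u zero) refl
  where
  cases : ∀ h (c : Code m h) → (∀ x → partner c x ≡ truncate u x) → ∀ z → u zero ≡ z →
          ∃[ h ] Σ (Code (suc m) h) λ c → ∀ x → partner c x ≡ u x
  cases h c pc zero e = suc h , fixed c , go
    where
    go : ∀ x → partner (fixed c) x ≡ u x
    go zero = sym e
    go (suc x) with u (suc x) in e′
    ... | zero = contradiction (trans (sym (inv (suc x))) (trans (cong u e′) e)) λ ()
    ... | suc y = cong suc (trans (pc x) (truncate-suc u e′))
  cases h c pc (suc y) e with fix-surjective c y (trans (pc y)
      (truncate-zero u (trans (cong u (sym e)) (inv zero))))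
  cases (suc h) c pc (suc _) e | j , refl = h , close c j , go
    where
    go : ∀ x → partner (close c j) x ≡ u x
    go zero = sym e
    go (suc x) with x Fin.≟ fix c j
    ... | yes refl = trans (sym (inv zero)) (cong u e)
    ... | no ne with u (suc x) in e′
    ...   | zero = contradiction (Finₚ.suc-injective (trans (sym (inv (suc x))) (trans (cong u e′) e))) ne
    ...   | suc y = cong suc (trans (pc x) (truncate-suc u e′))

partner-injective : ∀ {m h h'} (c : Code m h) (c' : Code m h') → (∀ x → partner c x ≡ partner c' x) →
                    _≡_ {A = ∃ (Code m)} (h , c) (h' , c')
partner-injective empty empty eq = refl
partner-injective (fixed c) (fixed c') eq with partner-injective c c' (λ x → Finₚ.suc-injective (eq (suc x)))
... | refl = refl
partner-injective (fixed c) (close c' j) eq = contradiction (eq zero) λ ()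
partner-injective (close c j) (fixed c') eq = contradiction (eq zero) λ ()
partner-injective (close c j) (close c' j') eq with partner-injective c c' eq′
  where
  e₀ : fix c j ≡ fix c' j'
  e₀ = Finₚ.suc-injective (eq zero)
  eq′ : ∀ x → partner c x ≡ partner c' x
  eq′ x with x Fin.≟ fix c j
  -- The place that `close` overwrites was fixed before, in both codes.
  ... | yes refl = trans (partner-fix c j) (trans e₀ (sym (trans (cong (partner c') e₀) (partner-fix c' j'))))
  ... | no ne = Finₚ.suc-injective (trans (sym (partner-close-≢ c j ne))
                  (trans (eq (suc x)) (partner-close-≢ c' j' (ne ∘ λ e → trans e (sym e₀)))))
... | refl with fix-injective c (Finₚ.suc-injective (eq zero))
...   | refl = refl

-- Forbidden patterns and how they arise

-- a, b, z are left ends: a is matched first, then b, and z last or never, so that a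
-- fixed point counts as an arc whose right end lies at infinity.  Numbers decrease
-- from left to right, hence "a is matched before b" reads u b < u a.
Pattern : (ℕ → ℕ → ℕ → Set) → ∀ {m} → (Fin m → Fin m) → Fin m → Fin m → Fin m → Set
Pattern Pos u a b z = Pos (toℕ a) (toℕ b) (toℕ z) × u a Fin.< a × u a Fin.< b × u a Fin.< z ×
                      u b Fin.< u a × (u z ≡ z ⊎ u z Fin.< u b)

Contains : (ℕ → ℕ → ℕ → Set) → ∀ {m} → (Fin m → Fin m) → Set
Contains Pos u = ∃[ a ] ∃[ b ] ∃[ z ] Pattern Pos u a b z

Pos321 Pos213 : ℕ → ℕ → ℕ → Set
Pos321 a b z = z < b × b < a
Pos213 a b z = a < z × z < b

-- This lets the growth lemmas be proved once for both patterns. A new point on the right raises all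
-- old numbers by one, hence `up` and `down`; `irr` keeps b and z apart.
record Shiftable (Pos : ℕ → ℕ → ℕ → Set) : Set where
  field
    up   : ∀ {a b z} → Pos a b z → Pos (suc a) (suc b) (suc z)
    down : ∀ {a b z} → Pos (suc a) (suc b) (suc z) → Pos a b z
    irr  : ∀ {a b} → ¬ Pos a b b

shiftable321 : Shiftable Pos321
shiftable321 = record
  { up = λ (p , q) → s≤s p , s≤s q
  ; down = λ (p , q) → ℕ.s≤s⁻¹ p , ℕ.s≤s⁻¹ q
  ; irr = λ (p , _) → ℕₚ.<-irrefl refl p }

shiftable213 : Shiftable Pos213
shiftable213 = record
  { up = λ (p , q) → s≤s p , s≤s q
  ; down = λ (p , q) → ℕ.s≤s⁻¹ p , ℕ.s≤s⁻¹ q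
  ; irr = λ (_ , q) → ℕₚ.<-irrefl refl q }

-- j cannot be closed because it would complete a pattern in the role of b.
Blocked : (ℕ → ℕ → ℕ → Set) → ∀ {m h} → Code m h → Fin h → Set
Blocked Pos c j = ∃[ a ] ∃[ i ] Pos (toℕ a) (toℕ (fix c j)) (toℕ (fix c i)) × partner c a Fin.< a ×
                  partner c a Fin.< fix c j × partner c a Fin.< fix c i

module _ {Pos : ℕ → ℕ → ℕ → Set} (shiftable : Shiftable Pos) where
  open Shiftable shiftable

  contains-fixed⁺ : ∀ {m h} (c : Code m h) → Contains Pos (partner c) → Contains Pos (partner (fixed c))
  contains-fixed⁺ c (a , b , z , pos , p , q , r , s , t) =
    suc a , suc b , suc z , up pos , s≤s p , s≤s q , s≤s r , s≤s s ,
    Sum.map (cong suc) s≤s t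

  contains-fixed⁻ : ∀ {m h} (c : Code m h) → Contains Pos (partner (fixed c)) → Contains Pos (partner c)
  contains-fixed⁻ c (suc a , suc b , suc z , pos , s≤s p , s≤s q , s≤s r , s≤s s , inj₁ e) =
    a , b , z , down pos , p , q , r , s , inj₁ (Finₚ.suc-injective e)
  contains-fixed⁻ c (suc a , suc b , suc z , pos , s≤s p , s≤s q , s≤s r , s≤s s , inj₂ (s≤s l)) =
    a , b , z , down pos , p , q , r , s , inj₂ l

  contains-close⁺ : ∀ {m h} (c : Code m (suc h)) j → Contains Pos (partner c) →
      Contains Pos (partner (close c j))
  contains-close⁺ c j (a , b , z , pos , p , q , r , s , t) =
    suc a , suc b , suc z , up pos , p′ , q′ , r′ , s′ , t′
    where
    not-fix : ∀ {x} → partner c x Fin.< x → x ≢ fix c j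
    not-fix lt refl = <⇒≢ lt (partner-fix c j)
    ea = partner-close-≢ c j (not-fix p)
    eb = partner-close-≢ c j (not-fix (ℕₚ.<-trans s q))
    p′ : partner (close c j) (suc a) Fin.< suc a
    p′ rewrite ea = s≤s p
    q′ : partner (close c j) (suc a) Fin.< suc b
    q′ rewrite ea = s≤s q
    r′ : partner (close c j) (suc a) Fin.< suc z
    r′ rewrite ea = s≤s r
    s′ : partner (close c j) (suc b) Fin.< partner (close c j) (suc a)
    s′ rewrite ea | eb = s≤s s
    t′ : partner (close c j) (suc z) ≡ suc z ⊎ partner (close c j) (suc z) Fin.< partner (close c j) (suc b)
    t′ rewrite eb with z Fin.≟ fix c j
    ... | yes _ = inj₂ (s≤s z≤n)
    ... | no _ = Sum.map (cong suc) s≤s t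

  blocked⇒contains : ∀ {m h} (c : Code m (suc h)) j → Blocked Pos c j → Contains Pos (partner (close c j))
  blocked⇒contains c j (a , i , pos , p , q , r) = suc a , suc (fix c j) , suc (fix c i) , up pos , p′ , q′ ,
      r′ , s′ , t′
    where
    ea : partner (close c j) (suc a) ≡ suc (partner c a)
    ea = partner-close-≢ c j λ { refl → <⇒≢ p (partner-fix c j) }
    p′ : partner (close c j) (suc a) Fin.< suc a
    p′ rewrite ea = s≤s p
    q′ : partner (close c j) (suc a) Fin.< suc (fix c j)
    q′ rewrite ea = s≤s q
    r′ : partner (close c j) (suc a) Fin.< suc (fix c i)
    r′ rewrite ea = s≤s r
    s′ : partner (close c j) (suc (fix c j)) Fin.< partner (close c j) (suc a)
    s′ rewrite ea | partner-close-fix c j = s≤s z≤n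
    t′ : partner (close c j) (suc (fix c i)) ≡ suc (fix c i) ⊎ _
    t′ = inj₁ (trans (partner-close-≢ c j λ e → irr (subst (λ x → Pos (toℕ a) (toℕ (fix c j)) (toℕ x)) e pos))
                     (cong suc (partner-fix c i)))

  -- The newest point is the rightmost, so the new arc cannot be a, after which b must still be
  -- matched. If it is z, then z was fixed before and the pattern was already there. Only the role
  -- of b is left, and then z is still fixed.
  contains-close⁻ : ∀ {m h} (c : Code m (suc h)) j → Contains Pos (partner (close c j)) →
                    Contains Pos (partner c) ⊎ Blocked Pos c j
  contains-close⁻ c j (suc a , suc b , suc z , pos , p , q , r , s , t)
    with a Fin.≟ fix c j | b Fin.≟ fix c j | z Fin.≟ fix c j
  contains-close⁻ c j (suc a , suc b , suc z , pos , p , q , r , () , t) | yes _ | yes _ | _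
  contains-close⁻ c j (suc a , suc b , suc z , pos , p , q , r , () , t) | yes _ | no _ | _
  contains-close⁻ c j (suc a , suc b , suc z , pos , p , q , r , s , t) | no _ | yes e | yes e′
    = ⊥-elim (irr (subst (λ x → Pos (toℕ (Fin.suc a)) (toℕ (Fin.suc b)) (toℕ (Fin.suc x))) (trans e′ (sym e))
        pos))
  contains-close⁻ c j (suc a , suc b , suc z , pos , s≤s p , s≤s q , s≤s r , s , inj₁ e) | no _ | yes
      refl | no _
    with fix-surjective c z (Finₚ.suc-injective e)
  ... | i , refl = inj₂ (a , i , down pos , p , q , r)
  contains-close⁻ c j (suc a , suc b , suc z , pos , s≤s p , s≤s q , s≤s r , s≤s s , t) | no _ | no _ | yes refl
    = inj₁ (a , b , z , down pos , p , q , r , s , inj₁ (partner-fix c j))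
  contains-close⁻ c j (suc a , suc b , suc z , pos , s≤s p , s≤s q , s≤s r , s≤s s , inj₁ e) | no _ | no
      _ | no _
    = inj₁ (a , b , z , down pos , p , q , r , s , inj₁ (Finₚ.suc-injective e))
  contains-close⁻ c j (suc a , suc b , suc z , pos , s≤s p , s≤s q , s≤s r , s≤s s , inj₂ (s≤s l)) | no _ | no
      _ | no _
    = inj₁ (a , b , z , down pos , p , q , r , s , inj₂ l)

-- Matchings as involutions: fixed points, ranks and avoidance

indicator : ∀ {A : Set} → Dec A → ℕ
indicator (yes _) = 1
indicator (no _) = 0

indicator-⇔ : ∀ {A B : Set} (a? : Dec A) (b? : Dec B) → (A → B) → (B → A) → indicator a? ≡ indicator b?
indicator-⇔ (yes a) (yes b) f g = refl
indicator-⇔ (yes a) (no ¬b) f g = contradiction (f a) ¬b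
indicator-⇔ (no ¬a) (yes b) f g = contradiction (g b) ¬a
indicator-⇔ (no ¬a) (no ¬b) f g = refl

indicator-yes : ∀ {A : Set} (a? : Dec A) → A → indicator a? ≡ 1
indicator-yes a? a = indicator-⇔ a? (yes a) id id

indicator-no : ∀ {A : Set} (a? : Dec A) → ¬ A → indicator a? ≡ 0
indicator-no a? ¬a = indicator-⇔ a? (no ¬a) id id

length-filter-tabulate : ∀ {A : Set} {P : Pred A 0ℓ} (P? : Decidable P) {n} (f : Fin n → A) →
                         length (filter P? (List.tabulate f)) ≡ sum (λ i → indicator (P? (f i)))
length-filter-tabulate P? {zero} f = refl
length-filter-tabulate P? {suc n} f with P? (f zero)
... | yes _ = cong suc (length-filter-tabulate P? (f ∘ suc))
... | no _ = length-filter-tabulate P? (f ∘ suc)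

fixedCount : ∀ {m h} → Code m h → ℕ
fixedCount c = sum λ x → indicator (partner c x Fin.≟ x)

fixedCount≡ : ∀ {m h} (c : Code m h) → fixedCount c ≡ h
fixedCount≡ empty = refl
fixedCount≡ (fixed c) = cong suc (trans (sum-cong-≗ λ x →
    indicator-⇔ (suc (partner c x) Fin.≟ suc x) (partner c x Fin.≟ x) Finₚ.suc-injective (cong suc))
        (fixedCount≡ c))
fixedCount≡ {suc zero} (close () _)
fixedCount≡ {suc (suc m)} (close {h = h} c j) = ℕₚ.suc-injective (trans eq (fixedCount≡ c))
  where
  x₀ = fix c j
  f f′ : Fin (suc m) → ℕ
  f x = indicator (partner c x Fin.≟ x)
  f′ x = indicator (partner (close c j) (suc x) Fin.≟ suc x)
  elsewhere : ∀ x → f′ (punchIn x₀ x) ≡ f (punchIn x₀ x)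
  elsewhere x = indicator-⇔ _ _ (λ e → Finₚ.suc-injective
      (trans (sym (partner-close-≢ c j (Finₚ.punchInᵢ≢i x₀ x))) e))
                                (λ e → trans (partner-close-≢ c j (Finₚ.punchInᵢ≢i x₀ x)) (cong suc e))
  -- Among the old points only `x₀` changes status, and the newest point is matched.
  eq : suc (sum f′) ≡ sum f
  eq = begin
    suc (sum f′) ≡⟨ cong suc (sum-remove {i = x₀} f′) ⟩
    suc (f′ x₀ + sum (removeAt f′ x₀)) ≡⟨ cong (λ n → suc (n + sum (removeAt f′ x₀)))
      (indicator-no (partner (close c j) (suc x₀) Fin.≟ suc x₀) λ e →
          contradiction (trans (sym (partner-close-fix c j)) e) λ ()) ⟩
    suc (sum (removeAt f′ x₀)) ≡⟨ cong suc (sum-cong-≗ elsewhere) ⟩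
    1 + sum (removeAt f x₀) ≡⟨ cong (_+ sum (removeAt f x₀))
        (sym (indicator-yes (partner c x₀ Fin.≟ x₀) (partner-fix c j))) ⟩
    f x₀ + sum (removeAt f x₀) ≡⟨ sum-remove {i = x₀} f ⟨
    sum f ∎
    where open ≡-Reasoning

-- Vectors number the points from left to right and codes from right to left; conjugation by
-- `opposite` translates.
mirror : ∀ {m} → Vec (Fin m) m → Fin m → Fin m
mirror v x = opposite (lookup v (opposite x))

mirror-opposite : ∀ {m} (v : Vec (Fin m) m) x → mirror v (opposite x) ≡ opposite (lookup v x)
mirror-opposite v x = cong (opposite ∘ lookup v) (Finₚ.opposite-involutive x)

mirror-involutive : ∀ {m} (v : Vec (Fin m) m) → IsMatching v → ∀ x → mirror v (mirror v x) ≡ x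
mirror-involutive v inv x = trans (mirror-opposite v _)
    (trans (cong opposite (inv (opposite x))) (Finₚ.opposite-involutive x))

opposite-mono : ∀ {m} {x y : Fin m} → x Fin.< y → opposite y Fin.< opposite x
opposite-mono {m} {x} {y} lt rewrite Finₚ.opposite-prop x | Finₚ.opposite-prop y = ℕₚ.∸-monoʳ-< (s≤s lt)
    (Finₚ.toℕ<n y)

opposite-injective : ∀ {m} {x y : Fin m} → opposite x ≡ opposite y → x ≡ y
opposite-injective {x = x} {y} e = trans (sym (Finₚ.opposite-involutive x))
    (trans (cong opposite e) (Finₚ.opposite-involutive y))

numFixed≡ : ∀ {m h} (v : Vec (Fin m) m) (c : Code m h) → (∀ x → partner c x ≡ mirror v x) → numFixed v ≡ h
numFixed≡ {m} v c pc = begin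
  numFixed v ≡⟨ length-filter-tabulate (λ i → lookup v i Fin.≟ i) id ⟩
  sum (λ i → indicator (lookup v i Fin.≟ i)) ≡⟨ sum-permute (λ i → indicator (lookup v i Fin.≟ i))
      Perm.reverse ⟩
  sum (λ i → indicator (lookup v (opposite i) Fin.≟ opposite i))
      ≡⟨ sum-cong-≗ (λ x → indicator-⇔ _ _ (to x) (from x)) ⟩
  fixedCount c ≡⟨ fixedCount≡ c ⟩
  _ ∎
  where
  open ≡-Reasoning
  to : ∀ x → lookup v (opposite x) ≡ opposite x → partner c x ≡ x
  to x e = trans (pc x) (trans (cong opposite e) (Finₚ.opposite-involutive x))
  from : ∀ x → partner c x ≡ x → lookup v (opposite x) ≡ opposite x
  from x e = opposite-injective (trans (sym (pc x)) (trans e (sym (Finₚ.opposite-involutive x))))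

module _ {A : Set} {P Q : Pred A 0ℓ} (P? : Decidable P) (Q? : Decidable Q) (P⊆Q : ∀ {x} → P x → Q x) where

  length-filter-≤ : ∀ xs → length (filter P? xs) ≤ length (filter Q? xs)
  length-filter-≤ [] = z≤n
  length-filter-≤ (x ∷ xs) with P? x | Q? x
  ... | yes _ | yes _ = s≤s (length-filter-≤ xs)
  ... | yes p | no ¬q = contradiction (P⊆Q p) ¬q
  ... | no _ | yes _ = ℕₚ.m≤n⇒m≤1+n (length-filter-≤ xs)
  ... | no _ | no _ = length-filter-≤ xs

  length-filter-< : ∀ {x xs} → x ∈ xs → ¬ P x → Q x → length (filter P? xs) < length (filter Q? xs)
  length-filter-< {x} {_ ∷ xs} (here refl) ¬p q with P? x | Q? x
  ... | yes p | _ = contradiction p ¬p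
  ... | no _ | yes _ = s≤s (length-filter-≤ xs)
  ... | no _ | no ¬q = contradiction q ¬q
  length-filter-< {x} {y ∷ xs} (there x∈) ¬p q with P? y | Q? y
  ... | yes _ | yes _ = s≤s (length-filter-< x∈ ¬p q)
  ... | yes p | no ¬q = contradiction (P⊆Q p) ¬q
  ... | no _ | yes _ = ℕₚ.m≤n⇒m≤1+n (length-filter-< x∈ ¬p q)
  ... | no _ | no _ = length-filter-< x∈ ¬p q

before? : ∀ {m} (v : Vec (Fin m) m) (p : Fin m) → Decidable (λ i → i Fin.< p × ¬ lookup v i ≡ i)
before? v p i = (i Fin.<? p) ×-dec ¬? (lookup v i Fin.≟ i)

-- The rank of `q` counts `p`, that of `p` does not. With `rank-cancel-<`, relabelling preserves and
-- reflects the order of matched points, so occurrences in the reduced matching are occurrences in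
-- `v`.
rank-< : ∀ {m} (v : Vec (Fin m) m) {p q} → ¬ Fixed v p → p Fin.< q → rank v p < rank v q
rank-< v {p} {q} nf p<q =
  length-filter-< (before? v p) (before? v q) (λ (l , n) → ℕₚ.<-trans l p<q , n) (∈-tabulate⁺ p)
      (λ (l , _) → ℕₚ.<-irrefl refl l) (p<q , nf)

rank-cancel-< : ∀ {m} (v : Vec (Fin m) m) {p q} → rank v p < rank v q → p Fin.< q
rank-cancel-< v {p} {q} lt = ℕₚ.≰⇒> λ q≤p → ℕₚ.<⇒≱ lt
  (length-filter-≤ (before? v q) (before? v p) (λ (l , n) → ℕₚ.<-≤-trans l q≤p , n) (allFin _))

Avoiding : (ℕ → ℕ → ℕ → Set) → ∀ {m} → Vec (Fin m) m → Set
Avoiding Pos v = ¬ Contains Pos (mirror v)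

module _ {m} (v : Vec (Fin m) m) (inv : IsMatching v) where

  private
    opener-nonfixed : ∀ {x y} → InM v x y → ¬ Fixed v x
    opener-nonfixed (x<y , e) f = <⇒≢ x<y (trans (sym f) e)

    closer-nonfixed : ∀ {x y} → InM v x y → ¬ Fixed v y
    closer-nonfixed {x} {y} (x<y , e) f = <⇒≢ x<y (trans (sym (inv x)) (trans (cong (lookup v) e) f))

    redPair : ∀ {x y} → InM v x y → RedPair v (rank v x) (rank v y)
    redPair xy = _ , _ , xy , refl , refl

    rank-reflect : ∀ {p q a b} → rank v p ≡ a → rank v q ≡ b → a < b → p Fin.< q
    rank-reflect refl refl = rank-cancel-< v

    sequence : (a b c d e f : ℕ) → ℕ → ℕ
    sequence a b c d e f 0 = a
    sequence a b c d e f 1 = b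
    sequence a b c d e f 2 = c
    sequence a b c d e f 3 = d
    sequence a b c d e f 4 = e
    sequence a b c d e f _ = f

    increasing : ∀ {a b c d e f} → a < b → b < c → c < d → d < e → e < f →
                 ∀ t → t < 5 → sequence a b c d e f t < sequence a b c d e f (suc t)
    increasing p q r s t 0 _ = p
    increasing p q r s t 1 _ = q
    increasing p q r s t 2 _ = r
    increasing p q r s t 3 _ = s
    increasing p q r s t 4 _ = t
    increasing p q r s t (suc (suc (suc (suc (suc _))))) (s≤s (s≤s (s≤s (s≤s (s≤s ())))))

    arc : ∀ {x} → mirror v x Fin.< x → InM v (opposite x) (opposite (mirror v x))
    arc {x} lt = opposite-mono lt , sym (Finₚ.opposite-involutive _)

    mirror-arc : ∀ {x y} → InM v x y → mirror v (opposite x) ≡ opposite y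
    mirror-arc {x} (_ , e) = trans (mirror-opposite v x) (cong opposite e)

    mirror-fixed : ∀ {x} → Fixed v x → mirror v (opposite x) ≡ opposite x
    mirror-fixed {x} e = trans (mirror-opposite v x) (cong opposite e)

    fixed-mirror : ∀ {x} → mirror v x ≡ x → Fixed v (opposite x)
    fixed-mirror e = opposite-injective (trans e (sym (Finₚ.opposite-involutive _)))

    pattern-of-arcs : ∀ {Pos a b z a′ b′} → InM v a a′ → InM v b b′ →
        Pos (toℕ (opposite a)) (toℕ (opposite b)) (toℕ (opposite z)) →
                      b Fin.< a′ → z Fin.< a′ → a′ Fin.< b′ →
                          (Fixed v z ⊎ ∃[ z′ ] (lookup v z ≡ z′ × b′ Fin.< z′)) →
                      Contains Pos (mirror v)
    pattern-of-arcs {Pos} {a} {b} {z} {a′} {b′} aa bb pos ba za ab t =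
      opposite a , opposite b , opposite z , pos ,
      subst (Fin._< opposite a) (sym (mirror-arc aa)) (opposite-mono (proj₁ aa)) ,
      subst (Fin._< opposite b) (sym (mirror-arc aa)) (opposite-mono ba) ,
      subst (Fin._< opposite z) (sym (mirror-arc aa)) (opposite-mono za) ,
      subst₂ Fin._<_ (sym (mirror-arc bb)) (sym (mirror-arc aa)) (opposite-mono ab) ,
      Sum.map mirror-fixed (λ { (z′ , e , l) → subst₂ Fin._<_
          (sym (trans (mirror-opposite v z) (cong opposite e))) (sym (mirror-arc bb)) (opposite-mono l) }) t

  -- The last component of `Pattern` unites the two conditions: a fixed z violates `Cond321`, and a
  -- matched z completes an occurrence of 321.
  avoiding321⁺ : Avoids τ321 (RedPair v) → Cond321 v → Avoiding Pos321 v
  avoiding321⁺ av cond (a , b , z , (z<b , b<a) , aa , ab , az , ba , t) with t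
  ... | inj₁ e = cond _ _ _ _ _ (opposite-mono b<a) (opposite-mono z<b) (opposite-mono az) (opposite-mono ba)
                   (arc aa) (arc (ℕₚ.<-trans ba ab)) (fixed-mirror e)
  ... | inj₂ l = av (sequence (rank v x₁) (rank v x₂) (rank v x₃) (rank v x₄) (rank v x₅) (rank v x₆) ,
                   increasing (rank-< v (opener-nonfixed A) (opposite-mono b<a))
                       (rank-< v (opener-nonfixed B) (opposite-mono z<b))
                     (rank-< v (opener-nonfixed Z) (opposite-mono az))
                         (rank-< v (closer-nonfixed A) (opposite-mono ba))
                     (rank-< v (closer-nonfixed B) (opposite-mono l)) ,
                   λ { zero → redPair A ; (suc zero) → redPair B ; (suc (suc zero)) → redPair Z })
    where
    x₁ = opposite a
    x₂ = opposite b
    x₃ = opposite z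
    x₄ = opposite (mirror v a)
    x₅ = opposite (mirror v b)
    x₆ = opposite (mirror v z)
    A = arc aa
    B = arc (ℕₚ.<-trans ba ab)
    Z = arc (ℕₚ.<-trans l (ℕₚ.<-trans ba az))

  avoiding213⁺ : Avoids τ213 (RedPair v) → Cond213 v → Avoiding Pos213 v
  avoiding213⁺ av cond (a , b , z , (a<z , z<b) , aa , ab , az , ba , t) with t
  ... | inj₁ e = cond _ _ _ _ _ (opposite-mono z<b) (opposite-mono a<z) (opposite-mono aa) (opposite-mono ba)
                   (arc (ℕₚ.<-trans ba ab)) (arc aa) (fixed-mirror e)
  -- From left to right the left ends are b, z, a and the right ends are those of a, b, z.
  ... | inj₂ l = av (sequence (rank v x₁) (rank v x₂) (rank v x₃) (rank v x₄) (rank v x₅) (rank v x₆) ,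
                   increasing (rank-< v (opener-nonfixed B) (opposite-mono z<b))
                       (rank-< v (opener-nonfixed Z) (opposite-mono a<z))
                     (rank-< v (opener-nonfixed A) (opposite-mono aa))
                         (rank-< v (closer-nonfixed A) (opposite-mono ba))
                     (rank-< v (closer-nonfixed B) (opposite-mono l)) ,
                   λ { zero → redPair B ; (suc zero) → redPair Z ; (suc (suc zero)) → redPair A })
    where
    x₁ = opposite b
    x₂ = opposite z
    x₃ = opposite a
    x₄ = opposite (mirror v a)
    x₅ = opposite (mirror v b)
    x₆ = opposite (mirror v z)
    A = arc aa
    B = arc (ℕₚ.<-trans ba ab)
    Z = arc (ℕₚ.<-trans l (ℕₚ.<-trans ba az))

  avoiding321⁻ : Avoiding Pos321 v → Avoids τ321 (RedPair v) × Cond321 v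
  avoiding321⁻ av = occurrence , cond
    where
    occurrence : Avoids τ321 (RedPair v)
    occurrence (ι , inc , arcs) with arcs zero | arcs (suc zero) | arcs (suc (suc zero))
    ... | a , a′ , A , ra , ra′ | b , b′ , B , rb , rb′ | z , z′ , Z , rz , rz′ =
      av (pattern-of-arcs {Pos321} A B (opposite-mono b<z ,
          opposite-mono (rank-reflect ra rb (inc 0 (s≤s z≤n))))
           (ℕₚ.<-trans b<z z<a′) z<a′ (rank-reflect ra′ rb′ (inc 3 (s≤s (s≤s (s≤s (s≤s z≤n))))))
           (inj₂ (z′ , proj₂ Z , rank-reflect rb′ rz′ (inc 4 ℕₚ.≤-refl))))
      where
      b<z = rank-reflect rb rz (inc 1 (s≤s (s≤s z≤n)))
      z<a′ = rank-reflect rz ra′ (inc 2 (s≤s (s≤s (s≤s z≤n))))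
    cond : Cond321 v
    cond x₁ x₂ x₃ x₄ x₅ p q r s A B f =
      av (pattern-of-arcs {Pos321} A B (opposite-mono q , opposite-mono p) (ℕₚ.<-trans q r) r s (inj₁ f))

  avoiding213⁻ : Avoiding Pos213 v → Avoids τ213 (RedPair v) × Cond213 v
  avoiding213⁻ av = occurrence , cond
    where
    occurrence : Avoids τ213 (RedPair v)
    occurrence (ι , inc , arcs) with arcs zero | arcs (suc zero) | arcs (suc (suc zero))
    ... | b , b′ , B , rb , rb′ | z , z′ , Z , rz , rz′ | a , a′ , A , ra , ra′ =
      av (pattern-of-arcs {Pos213} A B (opposite-mono z<a , opposite-mono b<z)
           (ℕₚ.<-trans b<z (ℕₚ.<-trans z<a (proj₁ A))) (ℕₚ.<-trans z<a (proj₁ A))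
           (rank-reflect ra′ rb′ (inc 3 (s≤s (s≤s (s≤s (s≤s z≤n))))))
           (inj₂ (z′ , proj₂ Z , rank-reflect rb′ rz′ (inc 4 ℕₚ.≤-refl))))
      where
      b<z = rank-reflect rb rz (inc 0 (s≤s z≤n))
      z<a = rank-reflect rz ra (inc 1 (s≤s (s≤s z≤n)))
    cond : Cond213 v
    cond x₁ x₂ x₃ x₄ x₅ p q r s B A f =
      av (pattern-of-arcs {Pos213} A B (opposite-mono q , opposite-mono p) (ℕₚ.<-trans p (ℕₚ.<-trans q r))
          (ℕₚ.<-trans q r) s (inj₁ f))

-- Pairs of nested paths

-- Nested d s p q: p (lower) and q (upper) are paths of equal length read backwards,
-- d is the final height of p and s the excess of east steps of q over p.
data Nested : ℕ → ℕ → List Step → List Step → Set where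
  []  : Nested 0 0 [] []
  EE∷ : ∀ {d s p q} → Nested d s p q → Nested (suc d) s (E ∷ p) (E ∷ q)
  SE∷ : ∀ {d s p q} → Nested (suc d) s p q → Nested d (suc s) (S ∷ p) (E ∷ q)
  SS∷ : ∀ {d s p q} → Nested (suc d) s p q → Nested d s (S ∷ p) (S ∷ q)
  ES∷ : ∀ {d s p q} → Nested d (suc s) p q → Nested (suc d) s (E ∷ p) (S ∷ q)

-- Matchings avoiding 213

-- The fixed points numbered below free c are to the right of all left ends of arcs;
-- avoidance of 213 lets the others be closed only from right to left.
free : ∀ {m h} → Code m h → ℕ
free empty = 0
free (fixed c) = suc (free c)
free (close c j) = toℕ j

-- The lower path climbs from height h ∸ free c to h ∸ toℕ j just before the step that
-- closes j.  As it climbs only then, lower c never starts with E, hence is decodable.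
lower : ∀ {m h} → Code m h → List Step
lower empty = []
lower (fixed c) = lower c
lower (close c j) = S ∷ replicate (free c ∸ toℕ j) E ++ lower c

upper : ∀ {m h} → Code m h → List Step
upper empty = []
upper (fixed c) = E ∷ upper c
upper (close c j) = S ∷ upper c

Good : (ℕ → ℕ → ℕ → Set) → ∀ {m h} → Code m h → Set
Good Pos c = ¬ Contains Pos (partner c)

good-empty : ∀ {Pos} → Good Pos empty
good-empty (() , _)

Locked : ∀ {m h} → Code m h → Fin h → Set
Locked c i = ∃[ a ] partner c a Fin.< a × a Fin.< fix c i

-- Otherwise the fixed point numbered `free c` lies to the right of `j` and is locked. It stays open
-- when `j` is closed, so it plays z, and the left end that locks it plays a.
close-≤-free : ∀ {m h} (c : Code m (suc h)) j → (∀ i → free c ≤ toℕ i → Locked c i) → ¬ Blocked Pos213 c j →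
    toℕ j ≤ free c
close-≤-free c j locked nb = ℕₚ.≮⇒≥ bad
  where
  bad : ¬ free c < toℕ j
  bad lt = nb (a , i , (a<i , i<j) , ua<a , ℕₚ.<-trans ua<a (ℕₚ.<-trans a<i i<j) , ℕₚ.<-trans ua<a a<i)
    where
    bound = ℕₚ.<-trans lt (Finₚ.toℕ<n j)
    i = fromℕ< bound
    i≡ : toℕ i ≡ free c
    i≡ = Finₚ.toℕ-fromℕ< bound
    l = locked i (ℕₚ.≤-reflexive (sym i≡))
    a = proj₁ l
    ua<a = proj₁ (proj₂ l)
    a<i = proj₂ (proj₂ l)
    i<j : fix c i Fin.< fix c j
    i<j = fix-mono c (subst (_< toℕ j) (sym i≡) lt)

good-fixed⁻ : ∀ {Pos} → Shiftable Pos → ∀ {m h} (c : Code m h) → Good Pos (fixed c) → Good Pos c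
good-fixed⁻ sh c g = g ∘ contains-fixed⁺ sh c

good-fixed⁺ : ∀ {Pos} → Shiftable Pos → ∀ {m h} (c : Code m h) → Good Pos c → Good Pos (fixed c)
good-fixed⁺ sh c g = g ∘ contains-fixed⁻ sh c

good-close⁻ : ∀ {Pos} → Shiftable Pos → ∀ {m h} (c : Code m (suc h)) j → Good Pos (close c j) → Good Pos c ×
    ¬ Blocked Pos c j
good-close⁻ sh c j g = g ∘ contains-close⁺ sh c j , g ∘ blocked⇒contains sh c j

good-close⁺ : ∀ {Pos} → Shiftable Pos → ∀ {m h} (c : Code m (suc h)) j → Good Pos c → ¬ Blocked Pos c j →
    Good Pos (close c j)
good-close⁺ sh c j g nb = Sum.[ g , nb ] ∘ contains-close⁻ sh c j

≤⇒<punchIn : ∀ {n} (j : Fin (suc n)) {i : Fin n} → toℕ j ≤ toℕ i → j Fin.< punchIn j i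
≤⇒<punchIn j {i} le = subst (toℕ j <_) (sym (punchIn-≥ j i le)) (s≤s le)

free≤⇒locked : ∀ {m h} (c : Code m h) i → free c ≤ toℕ i → Locked c i
free≤⇒locked (fixed c) (suc i) (s≤s le) with free≤⇒locked c i le
... | a , p , q = suc a , s≤s p , s≤s q
free≤⇒locked (close c j) i le = suc (fix c j) , p , s≤s (fix-mono c (≤⇒<punchIn j le))
  where
  p : partner (close c j) (suc (fix c j)) Fin.< suc (fix c j)
  p rewrite partner-close-fix c j = s≤s z≤n

good-close-≤ : ∀ {m h} (c : Code m (suc h)) j → Good Pos213 (close c j) → toℕ j ≤ free c
good-close-≤ c j g = close-≤-free c j (free≤⇒locked c) (proj₂ (good-close⁻ shiftable213 c j g))

-- Closing `j` resets `free` to `j` and forgets the older left ends. This is sound because those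
-- lock only numbers from `free c` on, and `j` is at most `free c` in a good code.
locked⇒free≤ : ∀ {m h} (c : Code m h) → Good Pos213 c → ∀ i → Locked c i → free c ≤ toℕ i
locked⇒free≤ (fixed c) g (suc i) (suc a , s≤s p , s≤s q) = s≤s
    (locked⇒free≤ c (good-fixed⁻ shiftable213 c g) i (a , p , q))
locked⇒free≤ (close c j) g i (suc a , p , s≤s q) with a Fin.≟ fix c j
... | yes refl = ℕₚ.≮⇒≥ λ lt → ℕₚ.<-asym (subst (_< toℕ j) (sym (punchIn-< j i lt)) lt) (fix-cancel-< c q)
... | no _ = ℕₚ.≮⇒≥ λ lt → ℕₚ.<⇒≱ lt (ℕₚ.≤-trans (good-close-≤ c j g)
                (subst (free c ≤_) (punchIn-< j i lt)
                  (locked⇒free≤ c (proj₁ (good-close⁻ shiftable213 c j g)) (punchIn j i) (a , ℕ.s≤s⁻¹ p , q))))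

≤-free⇒¬blocked : ∀ {m h} (c : Code m (suc h)) j → Good Pos213 c → toℕ j ≤ free c → ¬ Blocked Pos213 c j
≤-free⇒¬blocked c j g le (a , i , (a<i , i<j) , ua<a , _) =
  ℕₚ.<⇒≱ (fix-cancel-< c i<j) (ℕₚ.≤-trans le (locked⇒free≤ c g i (a , ua<a , a<i)))

replicate-∸ : ∀ {A : Set} {x : A} j {n} (ys : List A) → j ≤ n →
    replicate n x ++ ys ≡ replicate j x ++ replicate (n ∸ j) x ++ ys
replicate-∸ zero ys le = refl
replicate-∸ (suc j) {suc n} ys (s≤s le) = cong (_ ∷_) (replicate-∸ j ys le)

-- Moves a south step of the lower path past i east steps, towards its end.
delay : ∀ i {d s r q} → Nested (suc (suc (i + d))) s (E ∷ replicate i E ++ r) q →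
    Nested (i + d) (suc s) (replicate i E ++ S ∷ r) q
delay zero (EE∷ w) = SE∷ w
delay zero (ES∷ w) = SS∷ w
delay (suc i) (EE∷ w) = EE∷ (delay i w)
delay (suc i) (ES∷ w) = ES∷ (delay i w)

-- Stripping east steps from `p` never lowers the excess. It stays positive, while empty words have
-- excess 0, so a south step of `p` must be met.
undelay : ∀ {d s p q} → Nested d (suc s) p q →
          ∃[ i ] ∃[ e ] ∃[ r ] d ≡ i + e × p ≡ replicate i E ++ S ∷ r ×
              Nested (suc (suc (i + e))) s (E ∷ replicate i E ++ r) q
undelay (SE∷ w) = 0 , _ , _ , refl , refl , EE∷ w
undelay (SS∷ w) = 0 , _ , _ , refl , refl , ES∷ w
undelay (EE∷ w) with undelay w
... | i , e , r , refl , refl , w′ = suc i , e , r , refl , refl , EE∷ w′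
undelay (ES∷ w) with undelay w
... | i , e , r , refl , refl , w′ = suc i , e , r , refl , refl , ES∷ w′

-- Of the `n` east steps owed, `n ∸ j` are performed before the new south step and `j` stay owed.
-- For positive `j` the last owed step is set against the south step of the upper path, and the new
-- south step replaces an earlier east step by `delay`.
close-lower : ∀ {h} j {n} (r : List Step) {q} → j ≤ h → j ≤ n → Nested (suc h) 0 (replicate n E ++ r) q →
              Nested h 0 (replicate j E ++ S ∷ replicate (n ∸ j) E ++ r) (S ∷ q)
close-lower zero r j≤h j≤n w = SS∷ w
close-lower (suc i) r j≤h j≤n w with ℕₚ.m≤n⇒∃[o]m+o≡n j≤h
... | d , refl = ES∷ (delay i (subst (λ p → Nested _ 0 p _) (replicate-∸ (suc i) r j≤n) w))

nested213 : ∀ {m h} (c : Code m h) → Good Pos213 c → Nested h 0 (replicate (free c) E ++ lower c) (upper c)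
nested213 empty g = []
nested213 (fixed c) g = EE∷ (nested213 c (good-fixed⁻ shiftable213 c g))
nested213 (close c j) g = close-lower (toℕ j) (lower c) (ℕ.s≤s⁻¹ (Finₚ.toℕ<n j)) (good-close-≤ c j g)
                            (nested213 c (proj₁ (good-close⁻ shiftable213 c j g)))

lower≢E∷ : ∀ {m h} (c : Code m h) {p} → lower c ≢ E ∷ p
lower≢E∷ (fixed c) e = lower≢E∷ c e

replicate-prefix : ∀ i {n} {p r : List Step} → (∀ {x} → p ≢ E ∷ x) → replicate n E ++ p ≡ replicate i E ++ r →
                   i ≤ n × replicate (n ∸ i) E ++ p ≡ r
replicate-prefix zero ne e = z≤n , e
replicate-prefix (suc i) {zero} ne e = contradiction e ne
replicate-prefix (suc i) {suc n} ne e with replicate-prefix i ne (Listₚ.∷-injectiveʳ e)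
... | le , eq = s≤s le , eq

code213 : ∀ q {h p} → Nested h 0 p q →
          Σ (Code (length q) h) λ c → Good Pos213 c × replicate (free c) E ++ lower c ≡ p × upper c ≡ q
code213 [] [] = empty , good-empty {Pos213} , refl , refl
code213 (E ∷ q) (EE∷ w) with code213 q w
... | c , g , refl , eq = fixed c , good-fixed⁺ shiftable213 c g , refl , cong (E ∷_) eq
code213 (S ∷ q) (SS∷ w) with code213 q w
... | c , g , refl , eq = close c zero , good-close⁺ shiftable213 c zero g (≤-free⇒¬blocked c zero g z≤n) ,
    refl , cong (S ∷_) eq
code213 (S ∷ q) (ES∷ w) with undelay w
... | i , e , r , refl , refl , w′ with code213 q w′
...   | c , g , eq′ , eq with replicate-prefix (suc i) (lower≢E∷ c) eq′
...     | le , refl = close c j , good-close⁺ shiftable213 c j g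
    (≤-free⇒¬blocked c j g (subst (_≤ free c) (sym j≡) le)) ,
                      cong (λ k → replicate k E ++ S ∷ replicate (free c ∸ k) E ++ lower c) j≡ , cong (S ∷_) eq
  where
  -- The lower word begins with exactly `suc i` east steps, and this number must be `free` of the
  -- new code.
  j : Fin (suc (suc (i + e)))
  j = fromℕ< {suc i} (s≤s (s≤s (ℕₚ.m≤m+n i e)))
  j≡ : toℕ j ≡ suc i
  j≡ = Finₚ.toℕ-fromℕ< (s≤s (s≤s (ℕₚ.m≤m+n i e)))

replicate-injective : ∀ {t t'} {p p' : List Step} → (∀ {x} → p ≢ E ∷ x) → (∀ {x} → p' ≢ E ∷ x) →
                      replicate t E ++ p ≡ replicate t' E ++ p' → t ≡ t' × p ≡ p'
replicate-injective {zero} {zero} ne ne' e = refl , e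
replicate-injective {zero} {suc _} ne ne' e = contradiction e ne
replicate-injective {suc _} {zero} ne ne' e = contradiction (sym e) ne'
replicate-injective {suc _} {suc _} ne ne' e with replicate-injective ne ne' (Listₚ.∷-injectiveʳ e)
... | refl , eq = refl , eq

lower-upper-injective : ∀ {m h h'} (c : Code m h) (c' : Code m h') → Good Pos213 c → Good Pos213 c' →
                        lower c ≡ lower c' → upper c ≡ upper c' → _≡_ {A = ∃ (Code m)} (h , c) (h' , c')
lower-upper-injective empty empty g g' el eu = refl
lower-upper-injective (fixed c) (fixed c') g g' el eu
  with lower-upper-injective c c' (good-fixed⁻ shiftable213 c g) (good-fixed⁻ shiftable213 c' g') el
      (Listₚ.∷-injectiveʳ eu)
... | refl = refl
lower-upper-injective (close c j) (close c' j') g g' el eu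
  with replicate-injective {free c ∸ toℕ j} {free c' ∸ toℕ j'} (lower≢E∷ c) (lower≢E∷ c')
      (Listₚ.∷-injectiveʳ el)
... | ef , el′ with lower-upper-injective c c' (proj₁ (good-close⁻ shiftable213 c j g))
    (proj₁ (good-close⁻ shiftable213 c' j' g')) el′ (Listₚ.∷-injectiveʳ eu)
-- Truncated subtraction cancels here because goodness puts both numbers at or below `free c`.
...   | refl with Finₚ.toℕ-injective (ℕₚ.∸-cancelˡ-≡ (good-close-≤ c j g) (good-close-≤ c j' g') ef)
...     | refl = refl

-- Matchings avoiding 321

-- A ballot word encodes a standard tableau with at most two rows on the fixed points:
-- E for the first row and S for the second, the largest entry coming first.
data Ballot : ∀ {h} → Vec Step h → ℕ → ℕ → Set where
  []  : Ballot [] 0 0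
  E∷_ : ∀ {h d s} {T : Vec Step h} → Ballot T d s → Ballot (E ∷ T) (suc d) s
  S∷_ : ∀ {h d s} {T : Vec Step h} → Ballot T (suc d) s → Ballot (S ∷ T) d (suc s)

-- Schensted row insertion of an entry at place j that bumps at most one entry: the letter
-- is S if the new entry ends the first row, E if an entry is bumped to the second row.
-- It is also the step of the lower path, whose height is the difference of the rows.
data Insert : Step → ∀ {h} → Vec Step h → Fin (suc h) → Vec Step (suc h) → Set where
  here : ∀ {h} {T : Vec Step h} → Insert S T zero (E ∷ T)
  skip : ∀ {h j} {T : Vec Step h} {T′} → Insert S T j T′ → Insert S (S ∷ T) (suc j) (S ∷ T′)
  bump : ∀ {h j} {T : Vec Step h} {T′} → Insert S T j T′ → Insert E (E ∷ T) (suc j) (S ∷ T′)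
  pass : ∀ {h j} {T : Vec Step h} {T′} → Insert E T j T′ → Insert E (E ∷ T) (suc j) (E ∷ T′)


-- The tableau is carried backwards in time: undoing the arrival of a point removes its
-- entry, which is the largest, and undoing a closure inserts the partner.
data Recording : ∀ {m h} → Code m h → Vec Step h → List Step → List Step → Set where
  empty : Recording empty [] [] []
  fixed : ∀ {m h} {c : Code m h} {T p q t} → Recording c T p q → Recording (fixed c) (t ∷ T) (t ∷ p) (E ∷ q)
  close : ∀ {m h} {c : Code m (suc h)} {j T T′ p q t} → Insert t T j T′ → Recording c T′ p q →
          Recording (close c j) T (t ∷ p) (S ∷ q)

-- Row insertion and its inverse

insert-deterministic : ∀ {h t t'} {T : Vec Step h} {j T₁ T₂} → Insert t T j T₁ → Insert t' T j T₂ → t ≡ t' ×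
    T₁ ≡ T₂
insert-deterministic here here = refl , refl
insert-deterministic (skip a) (skip b) with insert-deterministic a b
... | refl , refl = refl , refl
insert-deterministic (bump a) (bump b) with insert-deterministic a b
... | refl , refl = refl , refl
insert-deterministic (bump a) (pass b) with insert-deterministic a b
... | () , _
insert-deterministic (pass a) (bump b) with insert-deterministic a b
... | () , _
insert-deterministic (pass a) (pass b) with insert-deterministic a b
... | refl , refl = refl , refl

insert-injective : ∀ {h t} {T₁ T₂ : Vec Step h} {j₁ j₂ T} → Insert t T₁ j₁ T → Insert t T₂ j₂ T → T₁ ≡ T₂ ×
    j₁ ≡ j₂
insert-injective here here = refl , refl
insert-injective (skip a) (skip b) with insert-injective a b
... | refl , refl = refl , refl
insert-injective (bump a) (bump b) with insert-injective a b
... | refl , refl = refl , refl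
insert-injective (pass a) (pass b) with insert-injective a b
... | refl , refl = refl , refl

-- The entry taken out is the end of the first row, the first E of the word; it exists because the
-- first row is strictly longer.
remove-S : ∀ {h d s} {T : Vec Step (suc h)} → Ballot T (suc d) s → ∃[ T′ ] ∃[ j ] Insert S T′ j T ×
    Ballot T′ d s
remove-S (E∷ b) = _ , _ , here , b
remove-S {zero} (S∷_ {T = []} ())
remove-S {suc h} (S∷ b) with remove-S b
... | _ , _ , i , b′ = _ , _ , skip i , S∷ b′

-- The end of the second row, the first S, returns to the first row and expels the next smaller
-- entry there, the following E. The ballot condition guarantees that E.
remove-E : ∀ {h d s} {T : Vec Step (suc h)} → Ballot T d (suc s) → ∃[ T′ ] ∃[ j ] Insert E T′ j T ×
    Ballot T′ (suc d) s
remove-E {zero} (E∷_ {T = []} ())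
remove-E {suc h} (E∷ b) with remove-E b
... | _ , _ , i , b′ = _ , _ , pass i , E∷ b′
remove-E {zero} (S∷_ {T = []} ())
remove-E {suc h} (S∷ b) with remove-S b
... | _ , _ , i , b′ = _ , _ , bump i , E∷ b′

insert-S-ballot : ∀ {h d s} {T : Vec Step h} {j T′} → Insert S T j T′ → Ballot T d s → Ballot T′ (suc d) s
insert-S-ballot here b = E∷ b
insert-S-ballot (skip i) (S∷ b) = S∷ insert-S-ballot i b

-- A bump needs the largest entry of all to be in the first row, so that row is strictly longer. The
-- new entry takes the place of the bumped one, which lengthens the second row.
insert-E-ballot : ∀ {h d s} {T : Vec Step h} {j T′} → Insert E T j T′ → Ballot T d s →
                  ∃[ d′ ] d ≡ suc d′ × Ballot T′ d′ (suc s)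
insert-E-ballot (bump i) (E∷ b) = _ , refl , S∷ insert-S-ballot i b
insert-E-ballot (pass i) (E∷ b) with insert-E-ballot i b
... | _ , refl , b′ = _ , refl , E∷ b′

insert-at : ∀ {h t} {T : Vec Step h} {j T′} → Insert t T j T′ → lookup T′ j ≡ E
insert-at here = refl
insert-at (skip i) = insert-at i
insert-at (bump i) = insert-at i
insert-at (pass i) = insert-at i

-- Before place `j` the result reads E's and then S's, the entry just before `j` being S: it was in
-- the second row already or has just been bumped. With the E at `j` this yields a descent.
insert-above : ∀ {h t} {T : Vec Step h} {j T′} → Insert t T j T′ → ∀ (i : Fin (suc h)) → i Fin.< j →
               ∃[ k ] i Fin.≤ k × k Fin.< j × lookup T′ k ≡ S
insert-above (skip ins) zero _ = zero , z≤n , s≤s z≤n , refl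
insert-above (bump ins) zero _ = zero , z≤n , s≤s z≤n , refl
insert-above (pass (bump ins)) zero _ = suc zero , z≤n , s≤s (s≤s z≤n) , refl
insert-above (pass (pass ins)) zero _ with insert-above (pass ins) zero (s≤s z≤n)
... | k , _ , lt , e = suc k , z≤n , s≤s lt , e
insert-above (skip ins) (suc i) (s≤s lt) with insert-above ins i lt
... | k , le , lt′ , e = suc k , s≤s le , s≤s lt′ , e
insert-above (bump ins) (suc i) (s≤s lt) with insert-above ins i lt
... | k , le , lt′ , e = suc k , s≤s le , s≤s lt′ , e
insert-above (pass ins) (suc i) (s≤s lt) with insert-above ins i lt
... | k , le , lt′ , e = suc k , s≤s le , s≤s lt′ , e

insert-S⁺ : ∀ {h t} {T : Vec Step h} {j T′} → Insert t T j T′ → ∀ k → lookup T k ≡ S →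
    lookup T′ (punchIn j k) ≡ S
insert-S⁺ here k e = e
insert-S⁺ (skip ins) zero e = refl
insert-S⁺ (bump ins) zero e = refl
insert-S⁺ (skip ins) (suc k) e = insert-S⁺ ins k e
insert-S⁺ (bump ins) (suc k) e = insert-S⁺ ins k e
insert-S⁺ (pass ins) (suc k) e = insert-S⁺ ins k e

insert-below : ∀ {h t} {T : Vec Step h} {j T′} → Insert t T j T′ → ∀ k → toℕ j ≤ toℕ k →
    lookup T′ (punchIn j k) ≡ lookup T k
insert-below here k le = refl
insert-below (skip ins) (suc k) (s≤s le) = insert-below ins k le
insert-below (bump ins) (suc k) (s≤s le) = insert-below ins k le
insert-below (pass ins) (suc k) (s≤s le) = insert-below ins k le

insert-S-top : ∀ {h} {T : Vec Step h} {j T′} → Insert S T j T′ → (∀ k → toℕ k < toℕ j → lookup T k ≡ S) ×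
    (∀ k → k Fin.< j → lookup T′ k ≡ S)
insert-S-top here = (λ k ()) , (λ k ())
insert-S-top (skip ins) = (λ { zero _ → refl ; (suc k) (s≤s lt) → proj₁ (insert-S-top ins) k lt }) ,
                          (λ { zero _ → refl ; (suc k) (s≤s lt) → proj₂ (insert-S-top ins) k lt })

-- An S before an E above the inserted place is a second-row entry larger than the one to be bumped,
-- which would push it into a third row.
NoDescent : ∀ {h} → Vec Step h → ℕ → Set
NoDescent T j = ∀ k k' → k Fin.< k' → toℕ k' < j → lookup T k ≡ S → lookup T k' ≡ E → ⊥

S≢E : _≢_ {A = Step} S E
S≢E ()

insert-noDescent : ∀ {h t} {T : Vec Step h} {j T′} → Insert t T j T′ → NoDescent T (toℕ j) ×
    NoDescent T′ (toℕ j)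
insert-noDescent ins = source ins , target ins
  where
  source : ∀ {h t} {T : Vec Step h} {j T′} → Insert t T j T′ → NoDescent T (toℕ j)
  source (skip ins) k k' lt lt′ e e' = S≢E (trans (sym (proj₁ (insert-S-top (skip ins)) k' lt′)) e')
  source (bump ins) (suc k) (suc k') (s≤s lt) (s≤s lt′) e e' = S≢E
      (trans (sym (proj₁ (insert-S-top ins) k' lt′)) e')
  source (pass ins) (suc k) (suc k') (s≤s lt) (s≤s lt′) e e' = source ins k k' lt lt′ e e'
  target : ∀ {h t} {T : Vec Step h} {j T′} → Insert t T j T′ → NoDescent T′ (toℕ j)
  target (skip ins) k k' lt lt′ e e' = S≢E (trans (sym (proj₂ (insert-S-top (skip ins)) k' lt′)) e')
  target (bump ins) k (suc k') lt (s≤s lt′) e e' = S≢E (trans (sym (proj₂ (insert-S-top ins) k' lt′)) e')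
  target (pass ins) (suc k) (suc k') (s≤s lt) (s≤s lt′) e e' = target ins k k' lt lt′ e e'

insert-exists : ∀ {h} (T : Vec Step h) j → NoDescent T (toℕ j) → ∃[ t ] ∃[ T′ ] Insert t T j T′
insert-exists T zero nd = _ , _ , here
insert-exists (t ∷ T) (suc j) nd with insert-exists T j (λ k k' lt lt′ → nd (suc k) (suc k') (s≤s lt) (s≤s lt′))
insert-exists (S ∷ T) (suc j) nd | S , _ , ins = _ , _ , skip ins
insert-exists (S ∷ T) (suc j) nd | E , _ , bump ins = ⊥-elim
    (nd zero (suc zero) (s≤s z≤n) (s≤s (s≤s z≤n)) refl refl)
insert-exists (S ∷ T) (suc j) nd | E , _ , pass ins = ⊥-elim
    (nd zero (suc zero) (s≤s z≤n) (s≤s (s≤s z≤n)) refl refl)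
insert-exists (E ∷ T) (suc j) nd | S , _ , ins = _ , _ , bump ins
insert-exists (E ∷ T) (suc j) nd | E , _ , ins = _ , _ , pass ins

-- Arcs over pairs of fixed points

Covered : ∀ {m h} → Code m h → Fin h → Fin h → Set
Covered c i i' = ∃[ a ] partner c a Fin.< fix c i × fix c i' Fin.< a

-- Two fixed points below a common arc can only be closed from right to left, so the left one
-- is inserted first and the pair forms no descent.
Compatible : ∀ {m h} → Code m h → Vec Step h → Set
Compatible c T = ∀ i i' → i Fin.< i' → Covered c i i' → lookup T i ≡ S → lookup T i' ≡ E → ⊥

blocked⇒covered : ∀ {m h} (c : Code m (suc h)) {j} → Blocked Pos321 c j → ∃[ i ] i Fin.< j × Covered c i j
blocked⇒covered c (a , i , (i<j , j<a) , _ , _ , ai) = i , fix-cancel-< c i<j , a , ai , j<a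

covered⇒blocked : ∀ {m h} (c : Code m (suc h)) {i j} → i Fin.< j → Covered c i j → Blocked Pos321 c j
covered⇒blocked c {i} i<j (a , ai , j<a) =
  a , i , (fi<fj , j<a) , ℕₚ.<-trans (ℕₚ.<-trans ai fi<fj) j<a , ℕₚ.<-trans ai fi<fj , ai
  where fi<fj = fix-mono c i<j

covered-close : ∀ {m h} (c : Code m (suc h)) j {k k'} → k Fin.< k' → Covered c (punchIn j k) (punchIn j k') →
    Covered (close c j) k k'
covered-close c j {k} {k'} k<k' (a , p , q) = suc a , subst (Fin._< suc (fix c (punchIn j k)))
    (sym (partner-close-≢ c j ne)) (s≤s p) , s≤s q
  where
  ne : a ≢ fix c j
  ne refl = ℕₚ.<-asym (subst (Fin._< fix c (punchIn j k)) (partner-fix c j) p)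
                      (ℕₚ.<-trans (fix-mono c (punchIn-mono-< j k<k')) q)

covered-close-new : ∀ {m h} (c : Code m (suc h)) j {k k'} → toℕ k' < toℕ j → Covered (close c j) k k'
covered-close-new c j {k} {k'} lt = suc (fix c j) , subst (Fin._< suc (fix c (punchIn j k)))
    (sym (partner-close-fix c j)) (s≤s z≤n) ,
  s≤s (fix-mono c (subst (_< toℕ j) (sym (punchIn-< j k' lt)) lt))

covered-close⁻ : ∀ {m h} (c : Code m (suc h)) j {k k'} → Covered (close c j) k k' →
                 toℕ k' < toℕ j ⊎ Covered c (punchIn j k) (punchIn j k')
covered-close⁻ c j {k' = k'} (zero , p , ())
covered-close⁻ c j {k' = k'} (suc a , p , s≤s q) with a Fin.≟ fix c j
... | yes refl = inj₁ (ℕₚ.≰⇒> λ le → ℕₚ.<-asym (≤⇒<punchIn j le) (fix-cancel-< c q))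
... | no _ = inj₂ (a , ℕ.s≤s⁻¹ p , q)

compatible-fixed⁺ : ∀ {m h} (c : Code m h) {t T} → Compatible c T → Compatible (fixed c) (t ∷ T)
compatible-fixed⁺ c comp (suc i) (suc i') (s≤s lt) (suc a , s≤s p , s≤s q) = comp i i' lt (a , p , q)

compatible-fixed⁻ : ∀ {m h} (c : Code m h) {t T} → Compatible (fixed c) (t ∷ T) → Compatible c T
compatible-fixed⁻ c comp i i' lt (a , p , q) = comp (suc i) (suc i') (s≤s lt) (suc a , s≤s p , s≤s q)

fix-mono-≤ : ∀ {m h} (c : Code m h) {i i'} → i Fin.≤ i' → fix c i Fin.≤ fix c i'
fix-mono-≤ c i≤i' = ℕₚ.≮⇒≥ λ lt → ℕₚ.<⇒≱ (fix-cancel-< c lt) i≤i'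

module _ {m h} (c : Code m (suc h)) {t j} {T : Vec Step h} {T′} (ins : Insert t T j T′) where

  compatible-insert : ¬ Blocked Pos321 c j → Compatible (close c j) T → Compatible c T′
  compatible-insert nb comp i i' i<i' cov@(a , p , q) e e' with Finₚ.<-cmp i' j
  ... | tri< lt _ _ = proj₂ (insert-noDescent ins) i i' i<i' lt e e'
  ... | tri≈ _ refl _ = nb (covered⇒blocked c i<i' cov)
  ... | tri> _ _ j<i' with Finₚ.<-cmp i j
  -- Since `j` lies between the two, an arc over both also covers `i` and `j`.
  ...   | tri< i<j _ _ = nb (covered⇒blocked c i<j (a , p , ℕₚ.<-trans (fix-mono c j<i') q))
  ...   | tri≈ _ refl _ = S≢E (trans (sym e) (insert-at ins))
  ...   | tri> _ _ j<i = comp _ _ k<k' (covered-close c j k<k' (subst₂ (Covered c) (sym ik) (sym ik') cov))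
                              (trans (sym (same j<i ik)) e) (trans (sym (same j<i' ik')) e')
    where
    ik : punchIn j (punchOut (<⇒≢ j<i)) ≡ i
    ik = Finₚ.punchIn-punchOut (<⇒≢ j<i)
    ik' : punchIn j (punchOut (<⇒≢ j<i')) ≡ i'
    ik' = Finₚ.punchIn-punchOut (<⇒≢ j<i')
    k<k' : punchOut (<⇒≢ j<i) Fin.< punchOut (<⇒≢ j<i')
    k<k' = ℕₚ.≰⇒> λ le → ℕₚ.<⇒≱ i<i' (subst₂ Fin._≤_ ik' ik (Finₚ.punchIn-mono-≤ j _ _ le))
    same : ∀ {x k} → j Fin.< x → punchIn j k ≡ x → lookup T′ x ≡ lookup T k
    same {k = k} lt refl = insert-below ins k (ℕₚ.≮⇒≥ λ k<j →
        ℕₚ.<-asym lt (subst (_< toℕ j) (sym (punchIn-< j k k<j)) k<j))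

  -- An arc that blocks `j` covers it together with some `i` to its right. Insertion has left an S
  -- between them and an E at `j`, a descent under that arc.
  ¬blocked-insert : Compatible c T′ → ¬ Blocked Pos321 c j
  ¬blocked-insert comp bl =
    let (i , i<j , a , p , q) = blocked⇒covered c bl
        (k , i≤k , k<j , e) = insert-above ins i i<j
    in comp k j k<j (a , ℕₚ.<-≤-trans p (fix-mono-≤ c i≤k) , q) e (insert-at ins)

  -- Below `j` insertion changes no row, and it never takes an entry out of the second row. Hence a
  -- covered descent ending below `j` survives in `T′`; above `j` there is none.
  compatible-remove : Compatible c T′ → Compatible (close c j) T
  compatible-remove comp k k' k<k' cov e e' with toℕ k' ℕ.<? toℕ j | covered-close⁻ c j cov
  ... | yes lt | _ = proj₁ (insert-noDescent ins) k k' k<k' lt e e'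
  ... | no ge | inj₁ lt = ge lt
  ... | no ge | inj₂ cov′ = comp _ _ (punchIn-mono-< j k<k') cov′ (insert-S⁺ ins k e)
      (trans (insert-below ins k' (ℕₚ.≮⇒≥ ge)) e')

compatible⇒noDescent : ∀ {m h} (c : Code m (suc h)) j {T} → Compatible (close c j) T → NoDescent T (toℕ j)
compatible⇒noDescent c j comp k k' lt lt′ = comp k k' lt (covered-close-new c j lt′)

-- From codes avoiding 321 to nested words and back

record-code : ∀ {m h} (c : Code m h) {T d s} → Good Pos321 c → Compatible c T → Ballot T d s →
              ∃[ p ] ∃[ q ] Recording c T p q × Nested d s p q
record-code empty g comp [] = _ , _ , empty , []
record-code (fixed c) {E ∷ T} g comp (E∷ b) with record-code c (good-fixed⁻ shiftable321 c g)
    (compatible-fixed⁻ c {T = T} comp) b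
... | _ , _ , r , w = _ , _ , fixed r , EE∷ w
record-code (fixed c) {S ∷ T} g comp (S∷ b) with record-code c (good-fixed⁻ shiftable321 c g)
    (compatible-fixed⁻ c {T = T} comp) b
... | _ , _ , r , w = _ , _ , fixed r , SE∷ w
record-code (close c j) {T} g comp b with good-close⁻ shiftable321 c j g | insert-exists T j
    (compatible⇒noDescent c j {T} comp)
... | g′ , nb | S , _ , ins with record-code c g′ (compatible-insert c ins nb comp) (insert-S-ballot ins b)
...   | _ , _ , r , w = _ , _ , close ins r , SS∷ w
record-code (close c j) {T} g comp b | g′ , nb | E , _ , ins with insert-E-ballot ins b
...   | _ , refl , b′ with record-code c g′ (compatible-insert c ins nb comp) b′
...     | _ , _ , r , w = _ , _ , close ins r , ES∷ w

code321 : ∀ q {d s p} → Nested d s p q → ∃[ h ] Σ (Code (length q) h) λ c → ∃[ T ]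
          Recording c T p q × Good Pos321 c × Compatible c T × Ballot T d s
code321 [] [] = 0 , empty , [] , empty , good-empty {Pos321} , (λ ()) , []
code321 (E ∷ q) (EE∷ w) with code321 q w
... | h , c , T , r , g , comp , b = suc h , fixed c , E ∷ T , fixed r , good-fixed⁺ shiftable321 c g ,
    compatible-fixed⁺ c {T = T} comp , E∷ b
code321 (E ∷ q) (SE∷ w) with code321 q w
... | h , c , T , r , g , comp , b = suc h , fixed c , S ∷ T , fixed r , good-fixed⁺ shiftable321 c g ,
    compatible-fixed⁺ c {T = T} comp , S∷ b
code321 (S ∷ q) (SS∷ w) with code321 q w
... | zero , c , [] , r , g , comp , ()
... | suc h , c , T , r , g , comp , b with remove-S b
...   | T′ , j , ins , b′ = h , close c j , T′ , close ins r ,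
    good-close⁺ shiftable321 c j g (¬blocked-insert c ins comp) , compatible-remove c ins comp , b′
code321 (S ∷ q) (ES∷ w) with code321 q w
... | zero , c , [] , r , g , comp , ()
... | suc h , c , T , r , g , comp , b with remove-E b
...   | T′ , j , ins , b′ = h , close c j , T′ , close ins r ,
    good-close⁺ shiftable321 c j g (¬blocked-insert c ins comp) , compatible-remove c ins comp , b′

recording-deterministic : ∀ {m h} {c : Code m h} {T p q p' q'} → Recording c T p q → Recording c T p' q' →
    p ≡ p' × q ≡ q'
recording-deterministic empty empty = refl , refl
recording-deterministic (fixed r) (fixed r') with recording-deterministic r r'
... | refl , refl = refl , refl
recording-deterministic (close i r) (close i' r') with insert-deterministic i i'
... | refl , refl with recording-deterministic r r'
...   | refl , refl = refl , refl

recording-injective : ∀ {m h h'} {c : Code m h} {c' : Code m h'} {T T' p q} → Recording c T p q →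
    Recording c' T' p q →
                      _≡_ {A = ∃[ h ] Code m h × Vec Step h} (h , c , T) (h' , c' , T')
recording-injective empty empty = refl
recording-injective (fixed r) (fixed r') with recording-injective r r'
... | refl = refl
recording-injective (close i r) (close i' r') with recording-injective r r'
... | refl with insert-injective i i'
...   | refl , refl = refl

-- Nested pairs and the geometric definition of D2nk

#E #S : List Step → ℕ
#E [] = 0
#E (E ∷ r) = suc (#E r)
#E (S ∷ r) = #E r
#S [] = 0
#S (E ∷ r) = #S r
#S (S ∷ r) = suc (#S r)

length≡ : ∀ r → length r ≡ #E r + #S r
length≡ [] = refl
length≡ (E ∷ r) = cong suc (length≡ r)
length≡ (S ∷ r) = trans (cong suc (length≡ r)) (sym (ℕₚ.+-suc (#E r) (#S r)))

point : ℕ → List Step → ℤ × ℤ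
point m r = + #E r , + m - + #S r

move : Step → ℤ × ℤ → ℤ × ℤ
move E (x , y) = x +ℤ + 1 , y
move S (x , y) = x , y - + 1

endpoint-∷ʳ : ∀ D {x} pt → endpoint pt (D ++ x ∷ []) ≡ move x (endpoint pt D)
endpoint-∷ʳ [] {E} pt = refl
endpoint-∷ʳ [] {S} pt = refl
endpoint-∷ʳ (E ∷ D) pt = endpoint-∷ʳ D _
endpoint-∷ʳ (S ∷ D) pt = endpoint-∷ʳ D _

points-∷ʳ : ∀ D {x} pt → points pt (D ++ x ∷ []) ≡ points pt D ++ endpoint pt (D ++ x ∷ []) ∷ []
points-∷ʳ [] {E} pt = refl
points-∷ʳ [] {S} pt = refl
points-∷ʳ (E ∷ D) pt = cong (_ ∷_) (points-∷ʳ D _)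
points-∷ʳ (S ∷ D) pt = cong (_ ∷_) (points-∷ʳ D _)

move-point : ∀ m x r → move x (point m r) ≡ point m (x ∷ r)
move-point m E r = cong (λ n → + n , + m - + #S r) ((ℕₚ.+-comm (#E r) 1))
move-point m S r = cong (+ #E r ,_) (trans (ℤₚ.+-assoc (+ m) (ℤ.- + #S r) (ℤ.- + 1))
  (cong (+ m +ℤ_) (trans (sym (ℤₚ.neg-distrib-+ (+ #S r) (+ 1))) (cong (λ n → ℤ.- + n) (ℕₚ.+-comm (#S r) 1)))))

endpoint-reverse : ∀ m r → endpoint (start m) (reverse r) ≡ point m r
endpoint-reverse m [] = cong (+ 0 ,_) (sym (ℤₚ.+-identityʳ (+ m)))
endpoint-reverse m (x ∷ r) = begin
  endpoint (start m) (reverse (x ∷ r)) ≡⟨ cong (endpoint (start m)) (Listₚ.unfold-reverse x r) ⟩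
  endpoint (start m) (reverse r ++ x ∷ []) ≡⟨ endpoint-∷ʳ (reverse r) _ ⟩
  move x (endpoint (start m) (reverse r)) ≡⟨ cong (move x) (endpoint-reverse m r) ⟩
  move x (point m r) ≡⟨ move-point m x r ⟩
  point m (x ∷ r) ∎
  where open ≡-Reasoning

-- Words list the last step first, so the prefixes of the path are the `tails` of the word.
points-reverse : ∀ m r → points (start m) (reverse r) ≡ reverse (List.map (point m) (tails r))
points-reverse m [] = cong (_∷ []) (endpoint-reverse m [])
points-reverse m (x ∷ r) = begin
  points (start m) (reverse (x ∷ r)) ≡⟨ cong (points (start m)) (Listₚ.unfold-reverse x r) ⟩
  points (start m) (reverse r ++ x ∷ []) ≡⟨ points-∷ʳ (reverse r) _ ⟩
  points (start m) (reverse r) ++ endpoint (start m) (reverse r ++ x ∷ []) ∷ []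
    ≡⟨ cong₂ (λ a b → a ++ b ∷ []) (points-reverse m r)
        (trans (cong (endpoint (start m)) (sym (Listₚ.unfold-reverse x r))) (endpoint-reverse m (x ∷ r))) ⟩
  reverse (List.map (point m) (tails r)) ++ point m (x ∷ r) ∷ []
      ≡⟨ Listₚ.unfold-reverse (point m (x ∷ r)) (List.map (point m) (tails r)) ⟨
  reverse (List.map (point m) (tails (x ∷ r))) ∎
  where open ≡-Reasoning

module _ {P : ℤ × ℤ → Set} (m : ℕ) (r : List Step) where

  all-points⁻ : All P (points (start m) (reverse r)) → All (P ∘ point m) (tails r)
  all-points⁻ ps rewrite points-reverse m r = Allₚ.map⁻ (All.tabulate (All.lookup ps ∘ Anyₚ.reverse⁺))

  all-points⁺ : All (P ∘ point m) (tails r) → All P (points (start m) (reverse r))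
  all-points⁺ ps rewrite points-reverse m r = All.tabulate (All.lookup (Allₚ.map⁺ {P = P} ps) ∘ Anyₚ.reverse⁻)

  any-points⁻ : Any P (points (start m) (reverse r)) → Any (P ∘ point m) (tails r)
  any-points⁻ ps rewrite points-reverse m r = Anyₚ.map⁻ (Anyₚ.reverse⁻ ps)

  any-points⁺ : Any (P ∘ point m) (tails r) → Any P (points (start m) (reverse r))
  any-points⁺ ps rewrite points-reverse m r = Anyₚ.reverse⁺ (Anyₚ.map⁺ ps)

∸-cancelʳ-≤ℤ : ∀ m {a b} → + m - + a ≤ℤ + m - + b → b ≤ a
∸-cancelʳ-≤ℤ m {a} {b} le = ℕₚ.≮⇒≥ λ a<b → ℤₚ.<⇒≱ (ℤₚ.+-monoʳ-< (+ m) (ℤₚ.neg-mono-< (ℤ.+<+ a<b))) le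

∸-monoʳ-≤ℤ : ∀ m {a b} → b ≤ a → + m - + a ≤ℤ + m - + b
∸-monoʳ-≤ℤ m le = ℤₚ.+-monoʳ-≤ (+ m) (ℤₚ.neg-mono-≤ (ℤ.+≤+ le))

Dyck : List Step → Set
Dyck r = All (λ t → #S t ≤ #E t) (tails r)

isDyck⁻ : ∀ m r → IsDyck m (reverse r) → #E r ≡ m × #S r ≡ m × Dyck r
isDyck⁻ m r (end , above) = ℤₚ.+-injective (cong proj₁ e) ,
    sym (ℤₚ.+-injective (ℤₚ.i-j≡0⇒i≡j (+ m) (+ #S r) (cong proj₂ e))) ,
  All.map (∸-cancelʳ-≤ℤ m) (all-points⁻ m r above)
  where e = trans (sym (endpoint-reverse m r)) end

isDyck⁺ : ∀ r → #S r ≡ #E r → Dyck r → IsDyck (#E r) (reverse r)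
isDyck⁺ r e dyck = trans (endpoint-reverse _ r) (cong (+ #E r ,_)
    (ℤₚ.i≡j⇒i-j≡0 {+ #E r} {+ #S r} (cong +_ (sym e)))) ,
  all-points⁺ (#E r) r (All.map (∸-monoʳ-≤ℤ (#E r)) dyck)

Dominated : List Step → List Step → Set
Dominated p q = All (λ t → Any (λ t′ → #E t′ ≡ #E t × #S t′ ≤ #S t) (tails q)) (tails p)

notAbove⁻ : ∀ m p q → NotAbove m (reverse p) (reverse q) → Dominated p q
notAbove⁻ m p q na = All.map (Any.map (λ (e , le) → ℤₚ.+-injective e , ∸-cancelʳ-≤ℤ m le) ∘ any-points⁻ m q)
    (all-points⁻ m p na)

notAbove⁺ : ∀ m p q → Dominated p q → NotAbove m (reverse p) (reverse q)
notAbove⁺ m p q dom = all-points⁺ m p (All.map (any-points⁺ m q ∘ Any.map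
    (λ (e , le) → cong +_ e , ∸-monoʳ-≤ℤ m le)) dom)

-- Nested words are the pairs of Dyck words with domination

nested-counts : ∀ {d s p q} → Nested d s p q → #E p ≡ #S p + d × #E q ≡ #E p + s × length p ≡ length q
nested-counts [] = refl , refl , refl
nested-counts {suc d} (EE∷ {p = p} w) with nested-counts w
... | a , b , c = trans (cong suc a) (sym (ℕₚ.+-suc (#S p) d)) , cong suc b , cong suc c
nested-counts {d} {suc s} (SE∷ {p = p} w) with nested-counts w
... | a , b , c = trans a (ℕₚ.+-suc (#S p) d) , trans (cong suc b) (sym (ℕₚ.+-suc (#E p) s)) , cong suc c
nested-counts {d} (SS∷ {p = p} w) with nested-counts w
... | a , b , c = trans a (ℕₚ.+-suc (#S p) d) , b , cong suc c
nested-counts {suc d} {s} (ES∷ {p = p} w) with nested-counts w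
... | a , b , c = trans (cong suc a) (sym (ℕₚ.+-suc (#S p) d)) , trans b (ℕₚ.+-suc (#E p) s) , cong suc c

#S-antitone : ∀ p q → length p ≡ length q → #E p ≤ #E q → #S q ≤ #S p
#S-antitone p q len le = ℕₚ.+-cancelˡ-≤ (#E q) (#S q) (#S p) (begin
  #E q + #S q ≡⟨ length≡ q ⟨
  length q ≡⟨ len ⟨
  length p ≡⟨ length≡ p ⟩
  #E p + #S p ≤⟨ ℕₚ.+-monoˡ-≤ (#S p) le ⟩
  #E q + #S p ∎)
  where open ℕₚ.≤-Reasoning

module _ {d s p q} (w : Nested d s p q) where

  nested-#S≤#E : #S p ≤ #E p
  nested-#S≤#E = ℕₚ.m+n≤o⇒m≤o (#S p) (ℕₚ.≤-reflexive (sym (proj₁ (nested-counts w))))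

  nested-#E≤#E : #E p ≤ #E q
  nested-#E≤#E = ℕₚ.m+n≤o⇒m≤o (#E p) (ℕₚ.≤-reflexive (sym (proj₁ (proj₂ (nested-counts w)))))

  nested-#S≤#S : #S q ≤ #S p
  nested-#S≤#S = #S-antitone p q (proj₂ (proj₂ (nested-counts w))) nested-#E≤#E

  nested-#S≤#E-upper : #S q ≤ #E q
  nested-#S≤#E-upper = ℕₚ.≤-trans nested-#S≤#S (ℕₚ.≤-trans nested-#S≤#E nested-#E≤#E)

-- A path meets every abscissa up to its last one, and at an earlier point it has made no more south
-- steps.
reach : ∀ q n → n ≤ #E q → Any (λ t → #E t ≡ n × #S t ≤ #S q) (tails q)
reach [] zero le = here (refl , z≤n)
reach (S ∷ q) n le = there (Any.map (λ (e , le′) → e , ℕₚ.m≤n⇒m≤1+n le′) (reach q n le))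
reach (E ∷ q) n le with n ℕ.≟ suc (#E q)
... | yes e = here (sym e , ℕₚ.≤-refl)
... | no ne = there (reach q n (ℕ.s≤s⁻¹ (ℕₚ.≤∧≢⇒< le ne)))

nested-dominated-whole : ∀ {d s p q} → Nested d s p q → Any (λ t → #E t ≡ #E p × #S t ≤ #S p) (tails q)
nested-dominated-whole {p = p} {q} w =
  Any.map (λ (e , le) → e , ℕₚ.≤-trans le (nested-#S≤#S w)) (reach q (#E p) (nested-#E≤#E w))

nested-sound : ∀ {d s p q} → Nested d s p q → Dyck p × Dyck q × Dominated p q
nested-sound [] = z≤n ∷ [] , z≤n ∷ [] , here (refl , z≤n) ∷ []
nested-sound w@(EE∷ v) with nested-sound v
... | a , b , c = nested-#S≤#E w ∷ a , nested-#S≤#E-upper w ∷ b , nested-dominated-whole w ∷ All.map there c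
nested-sound w@(SE∷ v) with nested-sound v
... | a , b , c = nested-#S≤#E w ∷ a , nested-#S≤#E-upper w ∷ b , nested-dominated-whole w ∷ All.map there c
nested-sound w@(SS∷ v) with nested-sound v
... | a , b , c = nested-#S≤#E w ∷ a , nested-#S≤#E-upper w ∷ b , nested-dominated-whole w ∷ All.map there c
nested-sound w@(ES∷ v) with nested-sound v
... | a , b , c = nested-#S≤#E w ∷ a , nested-#S≤#E-upper w ∷ b , nested-dominated-whole w ∷ All.map there c

tails-length : ∀ (r : List Step) → All (λ t → length t ≤ length r) (tails r)
tails-length [] = ℕₚ.≤-refl {0} ∷ []
tails-length (x ∷ r) = ℕₚ.≤-refl ∷ All.map ℕₚ.m≤n⇒m≤1+n (tails-length r)

#E-∷ : ∀ x r → #E r ≤ #E (x ∷ r)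
#E-∷ E r = ℕₚ.n≤1+n (#E r)
#E-∷ S r = ℕₚ.≤-refl

tails-#E : ∀ r → All (λ t → #E t ≤ #E r) (tails r)
tails-#E [] = z≤n ∷ []
tails-#E (x ∷ r) = ℕₚ.≤-refl ∷ All.map (λ le → ℕₚ.≤-trans le (#E-∷ x r)) (tails-#E r)

dominated-#E : ∀ {p q} → Dominated p q → #E p ≤ #E q
dominated-#E {[]} dom = z≤n
dominated-#E {_ ∷ _} {q} (whole ∷ _) with All.lookupAny (tails-#E q) whole
... | le , e , _ = subst (_≤ #E q) e le

-- The full word `y ∷ q` cannot be the witness for a tail of `p`: equal east steps and no more south
-- steps would make it no longer than that tail.
dominated-tail : ∀ {x y p q} → length p ≡ length q → Dominated (x ∷ p) (y ∷ q) → Dominated p q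
dominated-tail {x} {y} {p} {q} len (_ ∷ dom) = All.zipWith (λ { {t} (le , any) → shorten {t} le any })
    (tails-length p , dom)
  where
  shorten : ∀ {t} → length t ≤ length p → Any (λ t′ → #E t′ ≡ #E t × #S t′ ≤ #S t) (tails (y ∷ q)) →
            Any (λ t′ → #E t′ ≡ #E t × #S t′ ≤ #S t) (tails q)
  shorten le (there any) = any
  shorten {t} le (here (e , le′)) = contradiction (begin-strict
    length q <⟨ ℕₚ.n<1+n _ ⟩
    length (y ∷ q) ≡⟨ length≡ (y ∷ q) ⟩
    #E (y ∷ q) + #S (y ∷ q) ≤⟨ ℕₚ.+-mono-≤ (ℕₚ.≤-reflexive e) le′ ⟩
    #E t + #S t ≡⟨ length≡ t ⟨
    length t ≤⟨ le ⟩
    length p ≡⟨ len ⟩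
    length q ∎) (ℕₚ.<-irrefl refl)
    where open ℕₚ.≤-Reasoning

n≮n+0 : ∀ {n o} → o ≡ n + 0 → ¬ n < o
n≮n+0 {n} refl lt = ℕₚ.<-irrefl (sym (ℕₚ.+-identityʳ n)) lt

-- Steps are peeled off from the end of the paths. A descent from height 0 contradicts the Dyck
-- condition, and a loss of excess at 0 contradicts domination, each at the full words.
nested-complete : ∀ p q → length p ≡ length q → Dyck p → Dominated p q → ∃[ d ] ∃[ s ] Nested d s p q
nested-complete [] [] len dyck dom = 0 , 0 , []
nested-complete (x ∷ p) (y ∷ q) len dyck@(above ∷ dyck′) dom
  with nested-complete p q (ℕₚ.suc-injective len) dyck′ (dominated-tail (ℕₚ.suc-injective len) dom)
nested-complete (E ∷ p) (E ∷ q) len dyck dom | d , s , w = suc d , s , EE∷ w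
nested-complete (S ∷ p) (E ∷ q) len (above ∷ _) dom | zero , s ,
    w = contradiction above (n≮n+0 (proj₁ (nested-counts w)))
nested-complete (S ∷ p) (E ∷ q) len dyck dom | suc d , s , w = d , suc s , SE∷ w
nested-complete (S ∷ p) (S ∷ q) len (above ∷ _) dom | zero , s ,
    w = contradiction above (n≮n+0 (proj₁ (nested-counts w)))
nested-complete (S ∷ p) (S ∷ q) len dyck dom | suc d , s , w = d , s , SS∷ w
nested-complete (E ∷ p) (S ∷ q) len dyck dom | d , zero , w =
  contradiction (dominated-#E {E ∷ p} {S ∷ q} dom) (n≮n+0 (proj₁ (proj₂ (nested-counts w))))
nested-complete (E ∷ p) (S ∷ q) len dyck dom | d , suc s , w = suc d , s , ES∷ w

isD2⁺ : ∀ {m p q} → Nested 0 0 p q → length q ≡ m + m → IsD2 m (reverse p , reverse q)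
isD2⁺ {m} {p} {q} w len = subst (λ m → IsDyck m (reverse p)) Ep≡m (isDyck⁺ p Sp≡Ep dp) ,
                          subst (λ m → IsDyck m (reverse q)) (trans Eq≡Ep Ep≡m) (isDyck⁺ q Sq≡Eq dq) ,
                              notAbove⁺ m p q dom
  where
  counts = nested-counts w
  sound = nested-sound w
  dp = proj₁ sound
  dq = proj₁ (proj₂ sound)
  dom = proj₂ (proj₂ sound)
  Sp≡Ep : #S p ≡ #E p
  Sp≡Ep = trans (sym (ℕₚ.+-identityʳ _)) (sym (proj₁ counts))
  Eq≡Ep : #E q ≡ #E p
  Eq≡Ep = trans (proj₁ (proj₂ counts)) (ℕₚ.+-identityʳ _)
  len≡ : length p ≡ length q
  len≡ = proj₂ (proj₂ counts)
  Sq≡Eq : #S q ≡ #E q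
  Sq≡Eq = trans (ℕₚ.≤-antisym (#S-antitone p q len≡ (ℕₚ.≤-reflexive (sym Eq≡Ep)))
                              (#S-antitone q p (sym len≡) (ℕₚ.≤-reflexive Eq≡Ep)))
                (trans Sp≡Ep (sym Eq≡Ep))
  -- `Nested` does not mention `m`; it is recovered as half the length.
  double : #E p + #E p ≡ m + m
  double = trans (cong (λ n → #E p + n) (sym Sp≡Ep)) (trans (sym (length≡ p)) (trans len≡ len))
  Ep≡m : #E p ≡ m
  Ep≡m = halve double
    where
    halve : ∀ {a b} → a + a ≡ b + b → a ≡ b
    halve {a} {b} e with ℕₚ.<-cmp a b
    ... | tri< lt _ _ = contradiction e (ℕₚ.<⇒≢ (ℕₚ.+-mono-< lt lt))
    ... | tri≈ _ eq _ = eq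
    ... | tri> _ _ gt = contradiction (sym e) (ℕₚ.<⇒≢ (ℕₚ.+-mono-< gt gt))

isD2⁻ : ∀ {m p q} → IsD2 m (reverse p , reverse q) → Nested 0 0 p q × length q ≡ m + m
isD2⁻ {m} {p} {q} (dyck₀ , dyck₁ , na) =
  let (ep , sp , dp) = isDyck⁻ m p dyck₀
      (eq , sq , _) = isDyck⁻ m q dyck₁
      lq = trans (length≡ q) (cong₂ _+_ eq sq)
      (d , s , w) = nested-complete p q (trans (length≡ p) (trans (cong₂ _+_ ep sp) (sym lq))) dp
          (notAbove⁻ m p q na)
      (cp , cq , _) = nested-counts w
  in subst₂ (λ d s → Nested d s p q) (no-excess (trans (sym ep) (trans cp (cong (_+ d) sp))))
            (no-excess (trans (sym eq) (trans cq (cong (_+ s) ep)))) w , lq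
  where
  no-excess : ∀ {n} → m ≡ m + n → n ≡ 0
  no-excess e = ℕₚ.+-cancelˡ-≡ m _ 0 (trans (sym e) (sym (ℕₚ.+-identityʳ m)))

nested-append : ∀ k {d s p q} → Nested (k + d) s p q → Nested d s (replicate k S ++ p) (replicate k S ++ q)
nested-append zero w = w
nested-append (suc k) {d} {s} {p} {q} w = SS∷ (nested-append k
    (subst (λ e → Nested e s p q) (sym (ℕₚ.+-suc k d)) w))

nested-strip : ∀ k {d s p q} → Nested d s (replicate k S ++ p) (replicate k S ++ q) → Nested (k + d) s p q
nested-strip zero w = w
nested-strip (suc k) {d} {s} {p} {q} (SS∷ w) = subst (λ e → Nested e s p q) (ℕₚ.+-suc k d) (nested-strip k w)

reverse-replicate : ∀ {A : Set} k (x : A) → reverse (replicate k x) ≡ replicate k x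
reverse-replicate zero x = refl
reverse-replicate (suc k) x = trans (Listₚ.unfold-reverse x (replicate k x))
    (trans (cong (_++ x ∷ []) (reverse-replicate k x)) (snoc k))
  where
  snoc : ∀ k → replicate k x ++ x ∷ [] ≡ x ∷ replicate k x
  snoc zero = refl
  snoc (suc k) = cong (x ∷_) (snoc k)

reverse-append : ∀ k p → reverse (replicate k S ++ p) ≡ reverse p ++ replicate k S
reverse-append k p = trans (Listₚ.reverse-++ (replicate k S) p) (cong (reverse p ++_) (reverse-replicate k S))

-- Assembling the bijections

Represents : ∀ {m h} → Vec (Fin m) m → Code m h → Set
Represents v c = ∀ x → partner c x ≡ mirror v x

contains-cong : ∀ {Pos m} {u u' : Fin m → Fin m} → (∀ x → u x ≡ u' x) → Contains Pos u → Contains Pos u'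
contains-cong eq (a , b , z , pos , t) = a , b , z , pos , rest (eq a) (eq b) (eq z) t
  where
  rest : ∀ {ua ua' ub ub' uz uz'} → ua ≡ ua' → ub ≡ ub' → uz ≡ uz' →
         ua Fin.< a × ua Fin.< b × ua Fin.< z × ub Fin.< ua × (uz ≡ z ⊎ uz Fin.< ub) →
         ua' Fin.< a × ua' Fin.< b × ua' Fin.< z × ub' Fin.< ua' × (uz' ≡ z ⊎ uz' Fin.< ub')
  rest refl refl refl t = t

represent : ∀ {Pos m k} (v : Vec (Fin m) m) → IsMatching v → numFixed v ≡ k → Avoiding Pos v →
            Σ (Code m k) λ c → Represents v c × Good Pos c
represent {Pos} v inv refl av with encode (mirror v) (mirror-involutive v inv)
... | h , c , rep with numFixed≡ v c rep
...   | refl = c , rep , av ∘ contains-cong {Pos} rep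

unmirror : ∀ {m h} (c : Code m h) → Vec (Fin m) m
unmirror c = tabulate λ x → opposite (partner c (opposite x))

unmirror-represents : ∀ {m h} (c : Code m h) → Represents (unmirror c) c
unmirror-represents c x = sym (begin
  opposite (lookup (unmirror c) (opposite x)) ≡⟨ cong opposite (Vecₚ.lookup∘tabulate _ (opposite x)) ⟩
  opposite (opposite (partner c (opposite (opposite x)))) ≡⟨ Finₚ.opposite-involutive _ ⟩
  partner c (opposite (opposite x)) ≡⟨ cong (partner c) (Finₚ.opposite-involutive x) ⟩
  partner c x ∎)
  where open ≡-Reasoning

represents-lookup : ∀ {m h} {v : Vec (Fin m) m} {c : Code m h} → Represents v c → ∀ x →
    lookup v x ≡ opposite (partner c (opposite x))
represents-lookup {v = v} {c} rep x = trans (sym (Finₚ.opposite-involutive _))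
  (cong opposite (trans (sym (mirror-opposite v x)) (sym (rep (opposite x)))))

represents-isMatching : ∀ {m h} {v : Vec (Fin m) m} {c : Code m h} → Represents v c → IsMatching v
represents-isMatching {v = v} {c} rep x = begin
  lookup v (lookup v x) ≡⟨ represents-lookup {v = v} {c} rep (lookup v x) ⟩
  opposite (partner c (opposite (lookup v x))) ≡⟨ cong (opposite ∘ partner c)
      (trans (sym (mirror-opposite v x)) (sym (rep (opposite x)))) ⟩
  opposite (partner c (partner c (opposite x))) ≡⟨ cong opposite (partner-involutive c (opposite x)) ⟩
  opposite (opposite x) ≡⟨ Finₚ.opposite-involutive x ⟩
  x ∎
  where open ≡-Reasoning

represents-injective : ∀ {m h} {v v' : Vec (Fin m) m} {c : Code m h} → Represents v c → Represents v' c → v ≡ v'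
represents-injective {v = v} {v'} {c} rep rep' = begin
  v ≡⟨ Vecₚ.tabulate∘lookup v ⟨
  tabulate (lookup v) ≡⟨ Vecₚ.tabulate-cong (λ x → trans (represents-lookup {v = v} {c} rep x)
      (sym (represents-lookup {v = v'} {c} rep' x))) ⟩
  tabulate (lookup v') ≡⟨ Vecₚ.tabulate∘lookup v' ⟩
  v' ∎
  where open ≡-Reasoning

code-unique : ∀ {m h} {c c' : Code m h} → _≡_ {A = ∃ (Code m)} (h , c) (h , c') → c ≡ c'
code-unique refl = refl

represents-functional : ∀ {m h} {v : Vec (Fin m) m} {c c' : Code m h} → Represents v c → Represents v c' →
    c ≡ c'
represents-functional {c = c} {c'} rep rep' = code-unique
    (partner-injective c c' λ x → trans (rep x) (sym (rep' x)))

-- Bijections between refinements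

module _ {A B : Set} {P : A → Set} {Q : B → Set} (Rel : A → B → Set)
         (P-recompute : ∀ {a} → Recomputable (P a)) (Q-recompute : ∀ {b} → Recomputable (Q b))
         (forward : ∀ {a} → P a → ∃[ b ] Q b × Rel a b) (backward : ∀ {b} → Q b → ∃[ a ] P a × Rel a b)
         (functional : ∀ {a b b'} → P a → Rel a b → Rel a b' → b ≡ b')
         (injective : ∀ {a a' b} → P a → P a' → Rel a b → Rel a' b → a ≡ a') where

  -- The proofs in a `Refinement` are irrelevant and must be rebuilt by recomputation before
  -- `forward` or `backward` may use them. The map is controlled by its graph: `functional`
  -- identifies what `forward` finds with the element from which `backward` started.
  relation⇒bijection : Refinement A P ⤖ Refinement B Q
  relation⇒bijection = mk⤖ (f-injective , f-surjective)
    where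
    f : Refinement A P → Refinement B Q
    f (a , [ p ]) = let (b , q , _) = forward (P-recompute p) in b , [ q ]

    f-injective : ∀ {x y} → f x ≡ f y → x ≡ y
    f-injective {a , [ p ]} {a' , [ p' ]} eq = value-injective
      (injective (P-recompute p) (P-recompute p') (subst (Rel a) (cong value eq)
          (proj₂ (proj₂ (forward (P-recompute p)))))
                 (proj₂ (proj₂ (forward (P-recompute p')))))

    f-surjective : ∀ y → ∃[ x ] (∀ {z} → z ≡ x → f z ≡ y)
    f-surjective (b , [ q ]) = let (a , p , r) = backward (Q-recompute q) in
      (a , [ p ]) , λ { refl → value-injective (functional p (proj₂ (proj₂ (forward (P-recompute p)))) r) }

isDyck? : ∀ m D → Dec (IsDyck m D)
isDyck? m D = Productₚ.≡-dec ℤ._≟_ ℤ._≟_ _ _ ×-dec All.all? (λ (x , y) → (ℤ.+ m - x) ℤ.≤? y) _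

notAbove? : ∀ m D₀ D₁ → Dec (NotAbove m D₀ D₁)
notAbove? m D₀ D₁ = All.all? (λ (x , y) → Any.any? (λ (x′ , y′) → (x′ ℤ.≟ x) ×-dec (y ℤ.≤? y′)) _) _

_≟ˢ_ : (x y : Step) → Dec (x ≡ y)
E ≟ˢ E = yes refl
E ≟ˢ S = no λ ()
S ≟ˢ E = no λ ()
S ≟ˢ S = yes refl

endsWithS? : ∀ k D → Dec (EndsWithS k D)
endsWithS? k D with Listₚ.≡-dec _≟ˢ_ D (replicate k S)
... | yes e = yes ([] , e)
endsWithS? k [] | no ne = no λ { ([] , e) → ne e }
endsWithS? k (x ∷ D) | no ne = map′ (λ (P , e) → x ∷ P , cong (x ∷_) e)
  (λ { ([] , e) → contradiction e ne ; (_ ∷ P , e) → P , Listₚ.∷-injectiveʳ e }) (endsWithS? k D)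

-- This is all that depends on the pattern. Excess 0 says that the two paths meet, at height `k`,
-- where the padding begins.
record Correspondence (Pos : ℕ → ℕ → ℕ → Set) (m k : ℕ) : Set₁ where
  field
    Rel        : Code m k → List Step → List Step → Set
    forward    : ∀ c → Good Pos c → ∃[ p ] ∃[ q ] Rel c p q × Nested k 0 p q × length q ≡ m
    backward   : ∀ p q → Nested k 0 p q → length q ≡ m → ∃[ c ] Good Pos c × Rel c p q
    functional : ∀ {c p q p' q'} → Rel c p q → Rel c p' q' → p ≡ p' × q ≡ q'
    injective  : ∀ {c c' p q} → Good Pos c → Good Pos c' → Rel c p q → Rel c' p q → c ≡ c'

reversePadded : ℕ → List Step → List Step
reversePadded k p = reverse (replicate k S ++ p)

reversePadded-injective : ∀ k {p p'} → reversePadded k p ≡ reversePadded k p' → p ≡ p'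
reversePadded-injective k e = Listₚ.++-cancelˡ (replicate k S) _ _ (Listₚ.reverse-injective e)

endsWithS⇒reversePadded : ∀ k {D} → EndsWithS k D → ∃[ p ] D ≡ reversePadded k p
endsWithS⇒reversePadded k (P , refl) = reverse P , sym (trans (reverse-append k (reverse P))
    (cong (_++ replicate k S) (Listₚ.reverse-involutive P)))

padded-length : ∀ k (q : List Step) → length (replicate k S ++ q) ≡ k + length q
padded-length k q = trans (Listₚ.length-++ (replicate k S)) (cong (_+ length q) (Listₚ.length-replicate k))

double≡ : ∀ n k → (n + k) + (n + k) ≡ k + (2 * n + k)
double≡ = solve-∀

module _ (τ : Fin 3 → Fin 3) {cond : ∀ {m} → Vec (Fin m) m → Set} {Pos : ℕ → ℕ → ℕ → Set}
         (cond-recompute : ∀ {m} {v : Vec (Fin m) m} → Recomputable (cond v))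
         (avoiding⁺ : ∀ {m} (v : Vec (Fin m) m) → IsMatching v → Avoids τ (RedPair v) → cond v → Avoiding Pos v)
         (avoiding⁻ : ∀ {m} (v : Vec (Fin m) m) → IsMatching v → Avoiding Pos v → Avoids τ (RedPair v) × cond v)
         (n k : ℕ) (corr : Correspondence Pos (2 * n + k) k) where

  open Correspondence corr

  private
    m = 2 * n + k

    IsM : Vec (Fin m) m → Set
    IsM v = IsMatching v × numFixed v ≡ k × Avoids τ (RedPair v) × cond v

    IsD : List Step × List Step → Set
    IsD D = IsD2 (n + k) D × EndsWithS k (proj₁ D) × EndsWithS k (proj₂ D)

    record Related (v : Vec (Fin m) m) (D : List Step × List Step) : Set where
      constructor related
      field
        {code}     : Code m k
        {p q}      : List Step
        represents : Represents v code
        rel        : Rel code p q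
        eq         : D ≡ (reversePadded k p , reversePadded k q)

    isM-recompute : ∀ {v} → Recomputable (IsM v)
    isM-recompute {v} = recompute (Finₚ.all? λ i → lookup v (lookup v i) Fin.≟ i) ×-recompute
                        (recompute (numFixed v ℕ.≟ k) ×-recompute (¬-recompute ×-recompute cond-recompute))

    isD-recompute : ∀ {D} → Recomputable (IsD D)
    isD-recompute {D₀ , D₁} = recompute ((isDyck? _ D₀ ×-dec (isDyck? _ D₁ ×-dec notAbove? _ D₀ D₁)) ×-dec
                                         (endsWithS? k D₀ ×-dec endsWithS? k D₁))

    good : ∀ {v} {c : Code m k} → IsM v → Represents v c → Good Pos c
    good {v} {c} (inv , _ , av , cd) rep = avoiding⁺ v inv av cd ∘ contains-cong {Pos} rep

    to : ∀ {v} → IsM v → ∃[ D ] IsD D × Related v D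
    to {v} (inv , nf , av , cd) =
      let (c , rep , g) = represent {Pos} v inv nf (avoiding⁺ v inv av cd)
          (p , q , r , w , len) = forward c g
      in (reversePadded k p , reversePadded k q) ,
         (isD2⁺ (nested-append k (subst (λ d → Nested d 0 p q) (sym (ℕₚ.+-identityʳ k)) w))
                (trans (padded-length k q) (trans (cong (λ l → k + l) len) (sym (double≡ n k)))) ,
          (reverse p , reverse-append k p) , (reverse q , reverse-append k q)) ,
         related rep r refl

    from : ∀ {D} → IsD D → ∃[ v ] IsM v × Related v D
    from {_ , _} (d2 , e₀ , e₁) with endsWithS⇒reversePadded k e₀ | endsWithS⇒reversePadded k e₁
    ... | p , refl | q , refl =
      let (w , len) = isD2⁻ d2
          (c , g , r) = backward p q (subst (λ d → Nested d 0 p q) (ℕₚ.+-identityʳ k) (nested-strip k w))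
                          (ℕₚ.+-cancelˡ-≡ k _ _ (trans (sym (padded-length k q)) (trans len (double≡ n k))))
          v = unmirror c
          rep = unmirror-represents c
          inv = represents-isMatching {v = v} {c} rep
      in v , (inv , numFixed≡ v c rep , avoiding⁻ v inv (g ∘ contains-cong {Pos} (sym ∘ rep))) ,
          related rep r refl

    related-functional : ∀ {v D D'} → IsM v → Related v D → Related v D' → D ≡ D'
    related-functional {v} _ (related {c} rep r refl) (related {c'} rep' r' refl)
        with represents-functional {v = v} {c} {c'} rep rep'
    ... | refl with functional r r'
    ...   | refl , refl = refl

    related-injective : ∀ {v v' D} → IsM v → IsM v' → Related v D → Related v' D → v ≡ v'
    related-injective {v} {v'} mv mv' (related {c} {p} {q} rep r refl) (related {c'} {p'} {q'} rep' r' e)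
      with reversePadded-injective k {p} {p'} (cong proj₁ e) | reversePadded-injective k {q} {q'} (cong proj₂ e)
    ... | refl | refl with injective (good {v} {c} mv rep) (good {v'} {c'} mv' rep') r r'
    ...   | refl = represents-injective {v = v} {v'} {c} rep rep'

  correspondence⇒bijection : Mnk τ cond n k ⤖ D2nk n k
  correspondence⇒bijection = relation⇒bijection Related isM-recompute isD-recompute to from related-functional
      related-injective

length-upper : ∀ {m h} (c : Code m h) → length (upper c) ≡ m
length-upper empty = refl
length-upper (fixed c) = cong suc (length-upper c)
length-upper (close c j) = cong suc (length-upper c)

correspondence213 : ∀ m k → Correspondence Pos213 m k
correspondence213 m k = record
  { Rel = λ c p q → replicate (free c) E ++ lower c ≡ p × upper c ≡ q
  ; forward = λ c g → _ , _ , (refl , refl) , nested213 c g , length-upper c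
  ; backward = λ { p q w refl → let (c , g , ep , eq) = code213 q w in c , g , ep , eq }
  ; functional = λ { (refl , refl) (refl , refl) → refl , refl }
  ; injective = λ { {c} {c'} g g' (ep , eq) (ep' , eq') → code-unique (lower-upper-injective c c' g g'
      (proj₂ (replicate-injective {free c} {free c'} (lower≢E∷ c) (lower≢E∷ c') (trans ep (sym ep'))))
          (trans eq (sym eq'))) } }

ballot-replicate : ∀ k → Ballot (Vec.replicate k E) k 0
ballot-replicate zero = []
ballot-replicate (suc k) = E∷ ballot-replicate k

-- Paths that meet have excess 0, so the rebuilt tableau has no second row and is the single row
-- from which recording starts.
ballot-row : ∀ {h k} {T : Vec Step h} → Ballot T k 0 → _≡_ {A = ∃ (Vec Step)} (h , T) (k , Vec.replicate k E)
ballot-row [] = refl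
ballot-row (E∷ b) with ballot-row b
... | refl = refl

compatible-replicate : ∀ {m h} (c : Code m h) → Compatible c (Vec.replicate h E)
compatible-replicate c i i' _ _ e _ = S≢E (trans (sym e) (Vecₚ.lookup-replicate i E))

recording-length : ∀ {m h} {c : Code m h} {T p q} → Recording c T p q → length q ≡ m
recording-length empty = refl
recording-length (fixed r) = cong suc (recording-length r)
recording-length (close _ r) = cong suc (recording-length r)

correspondence321 : ∀ m k → Correspondence Pos321 m k
correspondence321 m k = record
  { Rel = λ c p q → Recording c (Vec.replicate k E) p q
  ; forward = λ c g → let (p , q , r , w) = record-code c g (compatible-replicate c) (ballot-replicate k) in
                      p , q , r , w , recording-length r
  ; backward = back
  ; functional = recording-deterministic
  ; injective = λ _ _ r r' → code-unique (cong (λ (h , c , _) → h , c) (recording-injective r r')) }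
  where
  back : ∀ p q → Nested k 0 p q → length q ≡ m → Σ (Code m k) λ c → Good Pos321 c ×
      Recording c (Vec.replicate k E) p q
  back p q w refl with code321 q w
  ... | h , c , T , r , g , comp , b with ballot-row b
  ...   | refl = c , g , r

cond321-recompute : ∀ {m} {v : Vec (Fin m) m} → Recomputable (Cond321 v)
cond321-recompute c x₁ x₂ x₃ x₄ x₅ p q r s a b f = ⊥-elim-irr (c x₁ x₂ x₃ x₄ x₅ p q r s a b f)

cond213-recompute : ∀ {m} {v : Vec (Fin m) m} → Recomputable (Cond213 v)
cond213-recompute c x₁ x₂ x₃ x₄ x₅ p q r s a b f = ⊥-elim-irr (c x₁ x₂ x₃ x₄ x₅ p q r s a b f)

theorem3p6 : ∀ (n k : ℕ) → (M321 n k ⤖ D2nk n k) × (M213 n k ⤖ D2nk n k)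
theorem3p6 n k =
  correspondence⇒bijection τ321 {Cond321} (λ {_} {v} → cond321-recompute {v = v}) avoiding321⁺ avoiding321⁻ n
      k (correspondence321 _ k) ,
  correspondence⇒bijection τ213 {Cond213} (λ {_} {v} → cond213-recompute {v = v}) avoiding213⁺ avoiding213⁻ n
      k (correspondence213 _ k)
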